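{- Let $\mathcal{G}$ be a class of graphs defined by two forbidden induced subgraphs. Call a pair $(H_1,H_2)$ listed if it satisfies one of the following conditions: (P1) $H_1\subseteq_i P_4$ or $H_2\subseteq_i P_4$; (P2) $\overline{H_1}\subseteq_i K_{1,t}+P_1$ and $H_2\subseteq_i K_{1,t}+P_1$ for some $t\geq 1$; (P3) $\overline{H_1}\subseteq_i tP_1+P_3$ and $H_2\subseteq_i tP_1+P_3$ for some $t\geq1$; (P4) $H_1\subseteq_i K_t$ and $H_2\subseteq_i 2K_{1,t}$, $K_{1,t}^+$ or $P_5$, for some $t\geq 1$; (P5) $H_1\subseteq_i \mathrm{paw}$ and $H_2\subseteq_i P_2+P_4$, $P_6$, $S_{1,2,2}$ or $K_{1,t}^{++}+P_1$ for some $t\geq1$; (P6) $H_1\subseteq_i\mathrm{diamond}$ and $H_2\subseteq_i P_1+2P_2$; (P7) $H_1\subseteq_i\mathrm{gem}$ and $H_2\subseteq_i P_1+P_4$ or $P_5$; (P8) $H_1\subseteq_i\overline{2P_1+P_3}$ and $H_2\subseteq_i P_2+P_3$ or $P_5$; (G1) neither $H_1$ nor $H_2$ is a path star forest; (G2) neither $\overline{H_1}$ nor $\overline{H_2}$ is a path star forest; (G3) $H_1\supseteq_i K_3$ and $H_2\supseteq_i 2P_1+2P_2$, $P_1+2P_3$, $2P_1+P_4$ or $3P_2$; (G4) $H_1\supseteq_i K_4$ and $H_2\supseteq_i K_{1,4}^{++}$, $P_1+2P_2$ or $P_1+P_4$; (G5) $H_1\supseteq_i K_5$ and $H_2\supseteq_i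 K_{1,3}^{++}$; (G6) $H_1\supseteq_i C_4$ and $H_2\supseteq_i K_{1,3}$, $3P_1+P_2$ or $2P_2$; (G7) $H_1\supseteq_i\mathrm{diamond}$ and $H_2\supseteq_i K_{1,3}$, $P_2+P_4$, $2P_3$ or $P_6$; (G8) $H_1\supseteq_i\mathrm{gem}$ and $H_2\supseteq_i P_1+2P_2$. Then $\mathcal{G}$ is not equivalent to the class of $(H_1,H_2)$-free graphs for any listed pair $(H_1,H_2)$ if and only if $\mathcal{G}$ is equivalent to the class of $(H_1,H_2)$-free graphs for one of the following six pairs: $(K_3,P_7)$, $(K_3,S_{1,2,3})$, $(K_4,S_{1,1,3})$, $(\mathrm{diamond},P_1+P_2+P_3)$, $(\mathrm{diamond},P_1+P_5)$, $(\mathrm{gem},P_2+P_3)$.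
   Context: All graphs are finite and simple. $H\subseteq_i G$ (equivalently $G\supseteq_i H$) means $H$ is isomorphic to an induced subgraph of $G$. $G+H$ is disjoint union, $rG$ the disjoint union of $r$ copies of $G$, $\overline{G}$ the complement. $C_t,K_t,K_{1,t},P_t$ are the cycle, complete graph, star and path ($K_{1,t}$ is the star with $t$ leaves). $K_{1,t}^+$ and $K_{1,t}^{++}$ are obtained from $K_{1,t}$ by subdividing one edge once, respectively twice. $S_{h,i,j}$ ($1\le h\le i\le j$) is the tree with exactly one vertex $x$ of degree 3 and exactly three leaves, at distances $h,i,j$ from $x$. The paw is $\overline{P_1+P_3}$, the diamond is $\overline{2P_1+P_2}$, the gem is $\overline{P_1+P_4}$. A subdivided star is a graph obtained from a star by subdividing its edges an arbitrary number of times; a path star forest is a graph each of whose connected components is a subdivided star. A graph is $(H_1,H_2)$-free if it has no induced subgraph isomorphic to $H_1$ or $H_2$. The class of $(H_1,H_2)$-free graphs is equivalent to the class of $(H_3,H_4)$-free graphs if the unordered pair $\{H_3,H_4\}$ can be obtained from $\{H_1,H_2\}$ by some combination of the operations: (a) complementing both graphs of the pair; (b) if one graph of the pair is $K_3$, replacing it by the paw, or vice versa. -}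

module Defs where

open import Data.Bool using (Bool; true; false; not; _∧_; _∨_)
open import Data.Nat using (ℕ; zero; suc; _+_; _∸_; _≤_; _≡ᵇ_)
open import Data.Fin using (Fin; toℕ; splitAt)
import Data.Fin as F
open import Data.List using (List; []; _∷_; replicate)
open import Data.Product using (Σ; _×_; _,_; ∃-syntax)
open import Data.Sum using (_⊎_; inj₁; inj₂)
open import Relation.Nullary using (¬_)
open import Relation.Nullary.Decidable using (⌊_⌋)
open import Relation.Binary.PropositionalEquality using (_≡_)
open import Relation.Binary.Construct.Closure.ReflexiveTransitive using (Star)
open import Function.Bundles using (_↔_; Inverse)
open import Function.Definitions using (Injective)

-- Finite simple graphs.
-- A graph has vertex set Fin size and a raw Boolean relation `rel`.
-- Its (simple) adjacency is the irreflexive symmetrisation of `rel`: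
--   Adj G i j = (i ≠ j) ∧ (rel i j ∨ rel j i).
-- Every finite simple graph arises this way (take rel = its adjacency),
-- and every such G describes a finite simple graph.

record Graph : Set where
  field
    size : ℕ
    rel  : Fin size → Fin size → Bool
open Graph public

Adj : (G : Graph) → Fin (size G) → Fin (size G) → Bool
Adj G i j = not ⌊ i F.≟ j ⌋ ∧ (rel G i j ∨ rel G j i)

_⊆ᵢ_ : Graph → Graph → Set
H ⊆ᵢ G = Σ (Fin (size H) → Fin (size G)) λ f →
  Injective _≡_ _≡_ f × (∀ i j → Adj H i j ≡ Adj G (f i) (f j))

_≅_ : Graph → Graph → Set
G ≅ H = Σ (Fin (size G) ↔ Fin (size H)) λ φ →
  ∀ i j → Adj G i j ≡ Adj H (Inverse.to φ i) (Inverse.to φ j)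

co : Graph → Graph
co G = record { size = size G ; rel = λ i j → not (Adj G i j) }

_⊕_ : Graph → Graph → Graph
G ⊕ H = record { size = size G + size H ; rel = r }
  where
  r : Fin (size G + size H) → Fin (size G + size H) → Bool
  r i j with splitAt (size G) i | splitAt (size G) j
  ... | inj₁ a | inj₁ b = rel G a b
  ... | inj₂ a | inj₂ b = rel H a b
  ... | _      | _      = false
infixl 6 _⊕_

K0 : Graph
K0 = record { size = 0 ; rel = λ _ _ → false }

copies : ℕ → Graph → Graph
copies zero G = K0
copies (suc r) G = G ⊕ copies r G

K : ℕ → Graph
K t = record { size = t ; rel = λ _ _ → true }

P : ℕ → Graph
P t = record { size = t ; rel = λ i j → toℕ j ≡ᵇ suc (toℕ i) }

-- Cycle C_t (t ≥ 3 intended): the path P_t plus the edge 0 - (t-1).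
C : ℕ → Graph
C t = record { size = t ; rel = λ i j →
  (toℕ j ≡ᵇ suc (toℕ i)) ∨ ((toℕ i ≡ᵇ 0) ∧ (toℕ j ≡ᵇ (t ∸ 1))) }

-- Subdivided stars ("spiders"): a centre (vertex 0) with legs that are
-- paths of the given lengths (numbers of vertices on each leg), the
-- first vertex of each leg adjacent to the centre.  A leg of length l
-- is the edge of the star subdivided l-1 times.

spiderSize : List ℕ → ℕ
spiderSize [] = 1
spiderSize (l ∷ ls) = spiderSize ls + l

spiderRel : (ls : List ℕ) → Fin (spiderSize ls) → Fin (spiderSize ls) → Bool
spiderRel [] _ _ = false
spiderRel (l ∷ ls) i j with splitAt (spiderSize ls) i | splitAt (spiderSize ls) j
... | inj₁ c | inj₁ d = spiderRel ls c d
... | inj₁ c | inj₂ a = (toℕ c ≡ᵇ 0) ∧ (toℕ a ≡ᵇ 0)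
... | inj₂ a | inj₂ b = toℕ b ≡ᵇ suc (toℕ a)
... | inj₂ _ | inj₁ _ = false

spider : List ℕ → Graph
spider ls = record { size = spiderSize ls ; rel = spiderRel ls }

Star1 : ℕ → Graph
Star1 t = spider (replicate t 1)

-- K_{1,t}^+ : one edge of K_{1,t} subdivided once (t ≥ 1 intended).
Star1⁺ : ℕ → Graph
Star1⁺ t = spider (2 ∷ replicate (t ∸ 1) 1)

-- K_{1,t}^{++} : one edge of K_{1,t} subdivided twice (t ≥ 1 intended).
Star1⁺⁺ : ℕ → Graph
Star1⁺⁺ t = spider (3 ∷ replicate (t ∸ 1) 1)

S : ℕ → ℕ → ℕ → Graph
S h i j = spider (h ∷ i ∷ j ∷ [])

paw diamond gem : Graph
paw = co (P 1 ⊕ P 3)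
diamond = co (copies 2 (P 1) ⊕ P 2)
gem = co (P 1 ⊕ P 4)

spiders : List (List ℕ) → Graph
spiders [] = K0
spiders (ls ∷ lss) = spider ls ⊕ spiders lss

PathStarForest : Graph → Set
PathStarForest G = Σ (List (List ℕ)) λ lss → G ≅ spiders lss

-- Equivalence of (H1,H2)-free classes: generated by swapping the pair
-- (pairs are unordered), isomorphism, complementing both graphs, and
-- replacing K3 by the paw or vice versa.

Pair : Set
Pair = Graph × Graph

data Step : Pair → Pair → Set where
  iso    : ∀ {A B C D} → A ≅ C → B ≅ D → Step (A , B) (C , D)
  swap   : ∀ {A B} → Step (A , B) (B , A)
  compl  : ∀ {A B} → Step (A , B) (co A , co B)
  k3→paw : ∀ {A B} → A ≅ K 3 → Step (A , B) (paw , B)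
  paw→k3 : ∀ {A B} → A ≅ paw → Step (A , B) (K 3 , B)

EquivClass : Pair → Pair → Set
EquivClass = Star Step

Listed : Graph → Graph → Set
Listed H1 H2 =
  ((H1 ⊆ᵢ P 4) ⊎ (H2 ⊆ᵢ P 4))
  ⊎ (∃[ t ] (1 ≤ t × (co H1 ⊆ᵢ (Star1 t ⊕ P 1)) × (H2 ⊆ᵢ (Star1 t ⊕ P 1))))
  ⊎ (∃[ t ] (1 ≤ t × (co H1 ⊆ᵢ (copies t (P 1) ⊕ P 3)) × (H2 ⊆ᵢ (copies t (P 1) ⊕ P 3))))
  ⊎ (∃[ t ] (1 ≤ t × (H1 ⊆ᵢ K t)
        × ((H2 ⊆ᵢ copies 2 (Star1 t)) ⊎ (H2 ⊆ᵢ Star1⁺ t) ⊎ (H2 ⊆ᵢ P 5))))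
  ⊎ ((H1 ⊆ᵢ paw)
        × ((H2 ⊆ᵢ (P 2 ⊕ P 4)) ⊎ (H2 ⊆ᵢ P 6) ⊎ (H2 ⊆ᵢ S 1 2 2)
           ⊎ (∃[ t ] (1 ≤ t × (H2 ⊆ᵢ (Star1⁺⁺ t ⊕ P 1))))))
  ⊎ ((H1 ⊆ᵢ diamond) × (H2 ⊆ᵢ (P 1 ⊕ copies 2 (P 2))))
  ⊎ ((H1 ⊆ᵢ gem) × ((H2 ⊆ᵢ (P 1 ⊕ P 4)) ⊎ (H2 ⊆ᵢ P 5)))
  ⊎ ((H1 ⊆ᵢ co (copies 2 (P 1) ⊕ P 3)) × ((H2 ⊆ᵢ (P 2 ⊕ P 3)) ⊎ (H2 ⊆ᵢ P 5)))
  ⊎ ((¬ PathStarForest H1) × (¬ PathStarForest H2))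
  ⊎ ((¬ PathStarForest (co H1)) × (¬ PathStarForest (co H2)))
  ⊎ ((K 3 ⊆ᵢ H1)
        × (((copies 2 (P 1) ⊕ copies 2 (P 2)) ⊆ᵢ H2) ⊎ ((P 1 ⊕ copies 2 (P 3)) ⊆ᵢ H2)
           ⊎ ((copies 2 (P 1) ⊕ P 4) ⊆ᵢ H2) ⊎ (copies 3 (P 2) ⊆ᵢ H2)))
  ⊎ ((K 4 ⊆ᵢ H1)
        × ((Star1⁺⁺ 4 ⊆ᵢ H2) ⊎ ((P 1 ⊕ copies 2 (P 2)) ⊆ᵢ H2) ⊎ ((P 1 ⊕ P 4) ⊆ᵢ H2)))
  ⊎ ((K 5 ⊆ᵢ H1) × (Star1⁺⁺ 3 ⊆ᵢ H2))
  ⊎ ((C 4 ⊆ᵢ H1)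
        × ((Star1 3 ⊆ᵢ H2) ⊎ ((copies 3 (P 1) ⊕ P 2) ⊆ᵢ H2) ⊎ (copies 2 (P 2) ⊆ᵢ H2)))
  ⊎ ((diamond ⊆ᵢ H1)
        × ((Star1 3 ⊆ᵢ H2) ⊎ ((P 2 ⊕ P 4) ⊆ᵢ H2) ⊎ (copies 2 (P 3) ⊆ᵢ H2) ⊎ (P 6 ⊆ᵢ H2)))
  ⊎ ((gem ⊆ᵢ H1) × ((P 1 ⊕ copies 2 (P 2)) ⊆ᵢ H2))

data SixPairs : Pair → Set where
  k3-p7       : SixPairs (K 3 , P 7)
  k3-s123     : SixPairs (K 3 , S 1 2 3)
  k4-s113     : SixPairs (K 4 , S 1 1 3)
  diamond-p123 : SixPairs (diamond , P 1 ⊕ P 2 ⊕ P 3)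
  diamond-p15 : SixPairs (diamond , P 1 ⊕ P 5)
  gem-p23     : SixPairs (gem , P 2 ⊕ P 3)

{-# OPTIONS --safe #-}

-- A path star forest whose complement is one as well embeds in P₄, and so falls under (P1): otherwise
-- it contains 3P₁ or 2P₂, and its complement a triangle or a C₄. Hence a class that avoids (G1), (G2)
-- and (P1) is given, up to complementation, by a pair (co F , B) where F and B are path star forests.
-- A path star forest that does not embed in P₄ contains 3P₁ or 2P₂; then (G3) or (G6) settles the
-- pair unless the other forest avoids 2P₁+2P₂, P₁+2P₃, 2P₁+P₄ and 3P₂. The forests avoiding these
-- four are explicit: a few sporadic ones and families with a parameter. All pairs of them are listed,
-- except the six.
--
-- Conversely the six classes comprise, up to isomorphism and the order of the pair, only sixteen
-- pairs of graphs. They are checked against the list by exhaustive search, where a family such as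
-- K₁ₜ + P₁ is replaced by the finite graph obtained by identifying vertices with the same neighbours.

module Submission where

open import Defs
open import Data.Bool using (Bool; true; false; not; _∧_; _∨_; T)
import Data.Bool as B
open import Data.Bool.Properties using (T-≡; T?; ∨-comm; ∨-idem; ∨-identityʳ; ∧-zeroʳ; ∧-identityʳ; not-involutive)
open import Data.Empty using (⊥; ⊥-elim)
open import Data.Fin using (Fin; zero; suc; toℕ; splitAt; join; _↑ˡ_; _↑ʳ_; inject≤)
import Data.Fin as F
import Data.Fin.Properties as FP
open import Data.List using (List; []; _∷_; replicate; _++_; map)
open import Data.List.Membership.Propositional using (_∈_; find; lose)
open import Data.List.Properties using (++-identityʳ)
open import Data.List.Relation.Binary.Permutation.Propositional as Perm using (_↭_; ↭-sym; ↭-reflexive)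
open import Data.List.Relation.Binary.Permutation.Propositional.Properties using (shift; ∷↭∷ʳ)
open import Data.List.Relation.Unary.Any using (any?; here; there)
open import Data.Nat using (ℕ; zero; suc; _+_; _∸_; _≤_; _<_; z≤n; s≤s; _≡ᵇ_)
import Data.Nat.Properties as NP
open import Data.Product using (Σ; _×_; _,_; proj₁; proj₂)
open import Data.Sum using (_⊎_; inj₁; inj₂; [_,_]′)
import Data.Sum as Sum
import Data.Sum.Properties as SumP
open import Function.Base using (_∘_; id; case_of_)
open import Function.Bundles using (Inverse; Equivalence; mk↔ₛ′)
open import Function.Definitions using (Injective)
open import Relation.Binary.Construct.Closure.ReflexiveTransitive using (ε; _◅_; _◅◅_)
open import Relation.Binary.Definitions using (tri<; tri≈; tri>)
open import Relation.Binary.PropositionalEquality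
open import Relation.Nullary using (¬_; Dec; yes; no)
open import Relation.Nullary.Decidable
  using (⌊_⌋; map′; _×-dec_; _⊎-dec_; from-yes; False; toWitnessFalse; decidable-stable)

-- Conditions (G1) and (G2) turn on whether a graph is a path star forest, and this is never
-- decided. The case split on it is made under a double negation, which comes off at the end because
-- membership in the six classes is decidable by a finite search. Families with a parameter are out
-- of reach of a search. An embedding that involves one is composed of monotonicity laws for sums
-- and legs and of a searched embedding between small graphs. For the converse, an embedding into a
-- member of a family, followed by the identification of twins, is a full homomorphism to a fixed
-- finite graph. This is only a necessary condition, as distinct vertices may collapse, but its
-- failure excludes all values of the parameter at once and suffices for the sixteen pairs. (G1) and
-- (G2) are refuted there by exhibiting forests.

-- Adjacency and exhaustive search

≟-refl : ∀ {n} (i : Fin n) → ⌊ i F.≟ i ⌋ ≡ true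
≟-refl i with i F.≟ i
... | yes _ = refl
... | no  n = ⊥-elim (n refl)

≟-≢ : ∀ {n} {i j : Fin n} → i ≢ j → ⌊ i F.≟ j ⌋ ≡ false
≟-≢ {i = i} {j} i≢j with i F.≟ j
... | yes p = ⊥-elim (i≢j p)
... | no  _ = refl

≟-inj : ∀ {m n} (f : Fin m → Fin n) → Injective _≡_ _≡_ f →
  ∀ i j → ⌊ f i F.≟ f j ⌋ ≡ ⌊ i F.≟ j ⌋
≟-inj f inj i j with i F.≟ j
... | yes refl = ≟-refl (f i)
... | no  i≢j  = ≟-≢ (i≢j ∘ inj)

Adj-sym : ∀ G i j → Adj G i j ≡ Adj G j i
Adj-sym G i j = cong₂ (λ x y → not x ∧ y) (lem i j) (∨-comm (rel G i j) _)
  where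
  lem : ∀ i j → ⌊ i F.≟ j ⌋ ≡ ⌊ j F.≟ i ⌋
  lem i j with i F.≟ j
  ... | yes refl = sym (≟-refl i)
  ... | no  i≢j  = sym (≟-≢ (i≢j ∘ sym))

Adj-irrefl : ∀ G i → Adj G i i ≡ false
Adj-irrefl G i = cong (λ x → not x ∧ (rel G i i ∨ rel G i i)) (≟-refl i)

anyF : ∀ {n} → (Fin n → Bool) → Bool
anyF {zero}  p = false
anyF {suc n} p = p zero ∨ anyF (p ∘ suc)

anyF-sound : ∀ {n} (p : Fin n → Bool) → anyF p ≡ true → Σ (Fin n) λ i → p i ≡ true
anyF-sound {suc n} p e with p zero in eq
... | true  = zero , eq
... | false = let i , q = anyF-sound (p ∘ suc) e in suc i , q

anyF-complete : ∀ {n} (p : Fin n → Bool) i → p i ≡ true → anyF p ≡ true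
anyF-complete p zero    e rewrite e = refl
anyF-complete p (suc i) e with p zero
... | true  = refl
... | false = anyF-complete (p ∘ suc) i e

∧-split : ∀ x y → x ∧ y ≡ true → x ≡ true × y ≡ true
∧-split true true _ = refl , refl

module _ {n : ℕ} where

  -- Once the first vertex is sent to `v`, its pair constraints become constraints on the single
  -- later vertices. A partial assignment is thus abandoned at its first conflict, which keeps
  -- evaluation during type checking feasible.
  search : ∀ m → (Fin m → Fin n → Bool) → (Fin m → Fin m → Fin n → Fin n → Bool) → Bool
  search zero    c ok = true
  search (suc m) c ok = anyF λ v → c zero v ∧
    search m (λ i w → c (suc i) w ∧ ok zero (suc i) v w) (λ i j → ok (suc i) (suc j))

  Solution : ∀ m → (Fin m → Fin n → Bool) → (Fin m → Fin m → Fin n → Fin n → Bool) → Set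
  Solution m c ok = Σ (Fin m → Fin n) λ f →
    (∀ i → c i (f i) ≡ true) × (∀ i j → i F.< j → ok i j (f i) (f j) ≡ true)

  search-sound : ∀ m c ok → search m c ok ≡ true → Solution m c ok
  search-sound zero    c ok _ = (λ ()) , (λ ()) , (λ ())
  search-sound (suc m) c ok e
    with v , q ← anyF-sound _ e
    with q₁ , q₂ ← ∧-split _ _ q
    with f , r₁ , r₂ ← search-sound m _ _ q₂ = g , g₁ , g₂
    where
    g : Fin (suc m) → Fin n
    g zero    = v
    g (suc i) = f i
    g₁ : ∀ i → c i (g i) ≡ true
    g₁ zero    = q₁
    g₁ (suc i) = proj₁ (∧-split _ _ (r₁ i))
    g₂ : ∀ i j → i F.< j → ok i j (g i) (g j) ≡ true
    g₂ zero    (suc j) _         = proj₂ (∧-split _ _ (r₁ j))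
    g₂ (suc i) (suc j) (s≤s i<j) = r₂ i j i<j

  search-complete : ∀ m c ok → Solution m c ok → search m c ok ≡ true
  search-complete zero    c ok _ = refl
  search-complete (suc m) c ok (f , p₁ , p₂) =
    anyF-complete _ (f zero) (cong₂ _∧_ (p₁ zero) (search-complete m _ _
      (f ∘ suc , (λ i → cong₂ _∧_ (p₁ (suc i)) (p₂ zero (suc i) (s≤s z≤n)))
               , (λ i j i<j → p₂ (suc i) (suc j) (s≤s i<j)))))

eqᵇ : Bool → Bool → Bool
eqᵇ true  y = y
eqᵇ false y = not y

eqᵇ-sound : ∀ x y → eqᵇ x y ≡ true → x ≡ y
eqᵇ-sound true  true  _ = refl
eqᵇ-sound false false _ = refl

eqᵇ-complete : ∀ {x y} → x ≡ y → eqᵇ x y ≡ true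
eqᵇ-complete {true}  refl = refl
eqᵇ-complete {false} refl = refl

-- Embeddings and isomorphism of finite graphs

-- Records, unlike the unfolding _⊆ᵢ_, let Agda infer the graphs.
infix 4 _↪_ _⇉_ _~_

record _↪_ (H G : Graph) : Set where
  constructor mk↪
  field
    fun : Fin (size H) → Fin (size G)
    inj : Injective _≡_ _≡_ fun
    adj : ∀ i j → Adj H i j ≡ Adj G (fun i) (fun j)
open _↪_ public

⊆→↪ : ∀ {H G} → H ⊆ᵢ G → H ↪ G
⊆→↪ (f , i , a) = mk↪ f i a

↪→⊆ : ∀ {H G} → H ↪ G → H ⊆ᵢ G
↪→⊆ (mk↪ f i a) = f , i , a

-- Full homomorphisms: like embeddings, but twins may be identified.
record _⇉_ (H G : Graph) : Set where
  constructor mk⇉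
  field
    hom : Fin (size H) → Fin (size G)
    full : ∀ i j → Adj H i j ≡ Adj G (hom i) (hom j)
open _⇉_ public

hom? : Graph → Graph → Bool
hom? H G = search (size H) (λ _ _ → true) λ i j v w → eqᵇ (Adj H i j) (Adj G v w)

hom?-complete : ∀ {H G} → H ⇉ G → hom? H G ≡ true
hom?-complete {H} {G} (mk⇉ f p) = search-complete (size H) _ _
  (f , (λ _ → refl) , λ i j _ → eqᵇ-complete {Adj H i j} {Adj G (f i) (f j)} (p i j))

emb? : Graph → Graph → Bool
emb? H G = search (size H) (λ _ _ → true) λ i j v w →
  not ⌊ v F.≟ w ⌋ ∧ eqᵇ (Adj H i j) (Adj G v w)

emb?-complete : ∀ {H G} → H ↪ G → emb? H G ≡ true
emb?-complete {H} {G} (mk↪ f inj p) = search-complete (size H) _ _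
  (f , (λ _ → refl) , λ i j i<j →
    cong₂ _∧_ (cong not (≟-≢ (FP.<⇒≢ i<j ∘ inj)))
      (eqᵇ-complete {Adj H i j} {Adj G (f i) (f j)} (p i j)))

-- The search compares pairs `i < j` only; symmetry and irreflexivity of `Adj` supply the others.
emb?-sound : ∀ {H G} → emb? H G ≡ true → H ↪ G
emb?-sound {H} {G} e with f , _ , q ← search-sound (size H) _ _ e = mk↪ f inj′ adj′
  where
  lt : ∀ i j → i F.< j → f i ≢ f j × Adj H i j ≡ Adj G (f i) (f j)
  lt i j i<j with a , b ← ∧-split _ _ (q i j i<j) =
    (λ e → case trans (sym a) (cong not (trans (cong (λ z → ⌊ z F.≟ f j ⌋) e) (≟-refl (f j)))) of λ ())
    , eqᵇ-sound _ _ b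
  inj′ : Injective _≡_ _≡_ f
  inj′ {i} {j} e with FP.<-cmp i j
  ... | tri< i<j _ _ = ⊥-elim (proj₁ (lt i j i<j) e)
  ... | tri≈ _ i≡j _ = i≡j
  ... | tri> _ _ j<i = ⊥-elim (proj₁ (lt j i j<i) (sym e))
  adj′ : ∀ i j → Adj H i j ≡ Adj G (f i) (f j)
  adj′ i j with FP.<-cmp i j
  ... | tri< i<j _ _  = proj₂ (lt i j i<j)
  ... | tri≈ _ refl _ = trans (Adj-irrefl H i) (sym (Adj-irrefl G (f i)))
  ... | tri> _ _ j<i  = trans (Adj-sym H i j) (trans (proj₂ (lt j i j<i)) (Adj-sym G (f j) (f i)))

-- For concrete graphs the search evaluates to `true`, and the implicit argument, now of unit type,
-- is filled in by eta.
emb! : ∀ {H G} → {t : T (emb? H G)} → H ↪ G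
emb! {t = t} = emb?-sound (Equivalence.to T-≡ t)

↪-refl : ∀ {G} → G ↪ G
↪-refl = mk↪ id id λ _ _ → refl

infixr 9 _⨾_
_⨾_ : ∀ {A B C} → A ↪ B → B ↪ C → A ↪ C
mk↪ f i a ⨾ mk↪ g j b = mk↪ (g ∘ f) (i ∘ j) λ x y → trans (a x y) (b (f x) (f y))

-- Stands in for isomorphism. Its two halves can be built, or searched for, independently and
-- without inverse laws; `~→≅` recovers the bijection.
record _~_ (G H : Graph) : Set where
  constructor _⇄_
  field
    to   : G ↪ H
    from : H ↪ G
open _~_ public

~-refl : ∀ {G} → G ~ G
~-refl = ↪-refl ⇄ ↪-refl

~-sym : ∀ {G H} → G ~ H → H ~ G
~-sym (f ⇄ g) = g ⇄ f

~-trans : ∀ {A B C} → A ~ B → B ~ C → A ~ C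
~-trans (f ⇄ g) (h ⇄ k) = (f ⨾ h) ⇄ (k ⨾ g)

≅→~ : ∀ {G H} → G ≅ H → G ~ H
≅→~ {G} {H} (φ , a) =
  mk↪ (Inverse.to φ) (λ e → trans (sym (Inverse.strictlyInverseʳ φ _))
    (trans (cong (Inverse.from φ) e) (Inverse.strictlyInverseʳ φ _))) a
  ⇄ mk↪ (Inverse.from φ) (λ e → trans (sym (Inverse.strictlyInverseˡ φ _))
    (trans (cong (Inverse.to φ) e) (Inverse.strictlyInverseˡ φ _)))
    λ i j → sym (trans (a _ _) (cong₂ (Adj H) (Inverse.strictlyInverseˡ φ i) (Inverse.strictlyInverseˡ φ j)))

-- Mutually embeddable finite graphs have equal sizes, so an embedding is bijective.
~→≅ : ∀ {G H} → G ~ H → G ≅ H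
~→≅ {G} {H} (mk↪ f i a ⇄ mk↪ g j b) = mk↔ₛ′ f f⁻¹ right left , a
  where
  surj : ∀ y → Σ (Fin (size G)) λ x → f x ≡ y
  surj y with FP.any? (λ x → f x F.≟ y)
  ... | yes p = p
  ... | no ¬p = ⊥-elim (NP.<-irrefl refl
        (NP.<-≤-trans (FP.injective⇒≤ {f = h} h-inj) (FP.injective⇒≤ {f = g} j)))
    where
    h : Fin (suc (size G)) → Fin (size H)
    h zero    = y
    h (suc x) = f x
    h-inj : Injective _≡_ _≡_ h
    h-inj {zero}  {zero}  _ = refl
    h-inj {zero}  {suc x} e = ⊥-elim (¬p (x , sym e))
    h-inj {suc x} {zero}  e = ⊥-elim (¬p (x , e))
    h-inj {suc x} {suc y} e = cong suc (i e)
  f⁻¹ : Fin (size H) → Fin (size G)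
  f⁻¹ y = proj₁ (surj y)
  right : ∀ y → f (f⁻¹ y) ≡ y
  right y = proj₂ (surj y)
  left : ∀ x → f⁻¹ (f x) ≡ x
  left x = i (right (f x))

Adj-co : ∀ G i j → Adj (co G) i j ≡ not ⌊ i F.≟ j ⌋ ∧ not (Adj G i j)
Adj-co G i j = cong (not ⌊ i F.≟ j ⌋ ∧_)
  (trans (cong (λ z → not (Adj G i j) ∨ not z) (Adj-sym G j i)) (∨-idem _))

co-↪ : ∀ {H G} → H ↪ G → co H ↪ co G
co-↪ {H} {G} (mk↪ f inj a) = mk↪ f inj λ i j →
  trans (Adj-co H i j) (trans (cong₂ (λ x y → not x ∧ not y) (sym (≟-inj f inj i j)) (a i j))
    (sym (Adj-co G (f i) (f j))))

co-~ : ∀ {H G} → H ~ G → co H ~ co G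
co-~ (f ⇄ g) = co-↪ f ⇄ co-↪ g

co-co : ∀ G → co (co G) ~ G
co-co G = mk↪ id id same ⇄ mk↪ id id (λ i j → sym (same i j))
  where
  same : ∀ i j → Adj (co (co G)) i j ≡ Adj G i j
  same i j = trans (Adj-co (co G) i j) (trans (cong (λ z → not ⌊ i F.≟ j ⌋ ∧ not z) (Adj-co G i j)) lem)
    where
    lem : not ⌊ i F.≟ j ⌋ ∧ not (not ⌊ i F.≟ j ⌋ ∧ not (Adj G i j)) ≡ Adj G i j
    lem with i F.≟ j
    ... | yes refl = refl
    ... | no  i≢j  = not-involutive _

-- Structural isomorphisms of disjoint unions

-- Graphs on arbitrary vertex types with a set of roots: sums and legs become
-- disjoint unions, on which the structural isomorphisms hold by computation.
record RootedGraph : Set₁ where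
  field
    V    : Set
    adjᵛ : V → V → Bool
    root : V → Bool
open RootedGraph

record _⊑_ (X Y : RootedGraph) : Set where
  constructor mk⊑
  field
    funᵛ  : V X → V Y
    injᵛ  : Injective _≡_ _≡_ funᵛ
    presᵛ : ∀ i j → adjᵛ X i j ≡ adjᵛ Y (funᵛ i) (funᵛ j)
    rootᵛ : ∀ i → root X i ≡ root Y (funᵛ i)
open _⊑_

⊑-refl : ∀ {X} → X ⊑ X
⊑-refl = mk⊑ id id (λ _ _ → refl) λ _ → refl

infixr 9 _⨾ᵛ_
_⨾ᵛ_ : ∀ {X Y Z} → X ⊑ Y → Y ⊑ Z → X ⊑ Z
mk⊑ f i a r ⨾ᵛ mk⊑ g j b s = mk⊑ (g ∘ f) (i ∘ j) (λ x y → trans (a x y) (b (f x) (f y)))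
  λ x → trans (r x) (s (f x))

rooted unrooted : Graph → RootedGraph
rooted   G = record { V = Fin (size G) ; adjᵛ = Adj G ; root = λ i → toℕ i ≡ᵇ 0 }
unrooted G = record { V = Fin (size G) ; adjᵛ = Adj G ; root = λ _ → false }

rooted→↪ : ∀ {G H} → rooted G ⊑ rooted H → G ↪ H
rooted→↪ (mk⊑ f i a _) = mk↪ f i a

unrooted→↪ : ∀ {G H} → unrooted G ⊑ unrooted H → G ↪ H
unrooted→↪ (mk⊑ f i a _) = mk↪ f i a

↪→unrooted : ∀ {G H} → G ↪ H → unrooted G ⊑ unrooted H
↪→unrooted (mk↪ f i a) = mk⊑ f i a λ _ → refl

infixl 6 _⊎ᵛ_
_⊎ᵛ_ : RootedGraph → RootedGraph → RootedGraph
X ⊎ᵛ Y = record { V = V X ⊎ V Y ; adjᵛ = a ; root = λ _ → false }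
  where
  a : V X ⊎ V Y → V X ⊎ V Y → Bool
  a (inj₁ x) (inj₁ y) = adjᵛ X x y
  a (inj₂ x) (inj₂ y) = adjᵛ Y x y
  a (inj₁ _) (inj₂ _) = false
  a (inj₂ _) (inj₁ _) = false

⊎-injective : ∀ {A B C D : Set} {f : A → C} {g : B → D} →
  Injective _≡_ _≡_ f → Injective _≡_ _≡_ g → Injective _≡_ _≡_ (Sum.map f g)
⊎-injective i j {inj₁ x} {inj₁ y} e = cong inj₁ (i (SumP.inj₁-injective e))
⊎-injective i j {inj₂ x} {inj₂ y} e = cong inj₂ (j (SumP.inj₂-injective e))

⊎ᵛ-mono : ∀ {X X′ Y Y′} → X ⊑ X′ → Y ⊑ Y′ → (X ⊎ᵛ Y) ⊑ (X′ ⊎ᵛ Y′)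
⊎ᵛ-mono (mk⊑ f i a _) (mk⊑ g j b _) = mk⊑ (Sum.map f g) (⊎-injective i j)
  (λ { (inj₁ x) (inj₁ y) → a x y ; (inj₁ _) (inj₂ _) → refl
     ; (inj₂ _) (inj₁ _) → refl ; (inj₂ x) (inj₂ y) → b x y })
  λ _ → refl

⊎ᵛ-swap : ∀ {X Y} → (X ⊎ᵛ Y) ⊑ (Y ⊎ᵛ X)
⊎ᵛ-swap = mk⊑ Sum.swap (λ { {inj₁ _} {inj₁ _} refl → refl ; {inj₂ _} {inj₂ _} refl → refl })
  (λ { (inj₁ x) (inj₁ y) → refl ; (inj₁ _) (inj₂ _) → refl
     ; (inj₂ _) (inj₁ _) → refl ; (inj₂ x) (inj₂ y) → refl })
  λ _ → refl

⊎ᵛ-assocʳ : ∀ {X Y Z} → (X ⊎ᵛ Y ⊎ᵛ Z) ⊑ (X ⊎ᵛ (Y ⊎ᵛ Z))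
⊎ᵛ-assocʳ = mk⊑ Sum.assocʳ
  (λ { {inj₁ (inj₁ _)} {inj₁ (inj₁ _)} refl → refl
     ; {inj₁ (inj₂ _)} {inj₁ (inj₂ _)} refl → refl
     ; {inj₂ _} {inj₂ _} refl → refl
     ; {inj₁ (inj₁ _)} {inj₁ (inj₂ _)} () ; {inj₁ (inj₁ _)} {inj₂ _} ()
     ; {inj₁ (inj₂ _)} {inj₁ (inj₁ _)} () ; {inj₁ (inj₂ _)} {inj₂ _} ()
     ; {inj₂ _} {inj₁ (inj₁ _)} () ; {inj₂ _} {inj₁ (inj₂ _)} () })
  (λ { (inj₁ (inj₁ _)) (inj₁ (inj₁ _)) → refl ; (inj₁ (inj₁ _)) (inj₁ (inj₂ _)) → refl
     ; (inj₁ (inj₁ _)) (inj₂ _) → refl ; (inj₁ (inj₂ _)) (inj₁ (inj₁ _)) → refl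
     ; (inj₁ (inj₂ _)) (inj₁ (inj₂ _)) → refl ; (inj₁ (inj₂ _)) (inj₂ _) → refl
     ; (inj₂ _) (inj₁ (inj₁ _)) → refl ; (inj₂ _) (inj₁ (inj₂ _)) → refl
     ; (inj₂ _) (inj₂ _) → refl })
  λ _ → refl

joinᵛ : ∀ G H → (unrooted G ⊎ᵛ unrooted H) ⊑ unrooted (G ⊕ H)
joinᵛ G H = mk⊑ (join m n) j-inj pres λ _ → refl
  where
  m = size G
  n = size H
  j-inj : Injective _≡_ _≡_ (join m n)
  j-inj {x} {y} e = trans (sym (FP.splitAt-join m n x)) (trans (cong (splitAt m) e) (FP.splitAt-join m n y))
  pres : ∀ x y → adjᵛ (unrooted G ⊎ᵛ unrooted H) x y ≡ Adj (G ⊕ H) (join m n x) (join m n y)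
  pres (inj₁ x) (inj₁ y)
    rewrite FP.splitAt-↑ˡ m x n | FP.splitAt-↑ˡ m y n | ≟-inj (_↑ˡ n) (FP.↑ˡ-injective n _ _) x y = refl
  pres (inj₂ x) (inj₂ y)
    rewrite FP.splitAt-↑ʳ m n x | FP.splitAt-↑ʳ m n y | ≟-inj (m ↑ʳ_) (FP.↑ʳ-injective m _ _) x y = refl
  pres (inj₁ x) (inj₂ y)
    rewrite FP.splitAt-↑ˡ m x n | FP.splitAt-↑ʳ m n y = sym (∧-zeroʳ _)
  pres (inj₂ x) (inj₁ y)
    rewrite FP.splitAt-↑ʳ m n x | FP.splitAt-↑ˡ m y n = sym (∧-zeroʳ _)

-- A section of an embedding is again an embedding. The split maps come from the join maps in this
-- way, so the case analysis on `splitAt` is made only once.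
inverseᵛ : ∀ {X Y} (f : X ⊑ Y) (g : V Y → V X) → (∀ y → funᵛ f (g y) ≡ y) → Y ⊑ X
inverseᵛ {X} {Y} f g fg = mk⊑ g
  (λ {x} {y} e → trans (sym (fg x)) (trans (cong (funᵛ f) e) (fg y)))
  (λ i j → sym (trans (presᵛ f (g i) (g j)) (cong₂ (adjᵛ Y) (fg i) (fg j))))
  λ i → sym (trans (rootᵛ f (g i)) (cong (root Y) (fg i)))

splitᵛ : ∀ G H → unrooted (G ⊕ H) ⊑ (unrooted G ⊎ᵛ unrooted H)
splitᵛ G H = inverseᵛ (joinᵛ G H) (splitAt (size G)) (FP.join-splitAt (size G) (size H))

⊕-mono : ∀ {A A′ B B′} → A ↪ A′ → B ↪ B′ → A ⊕ B ↪ A′ ⊕ B′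
⊕-mono {A} {A′} {B} {B′} f g =
  unrooted→↪ (splitᵛ A B ⨾ᵛ ⊎ᵛ-mono (↪→unrooted f) (↪→unrooted g) ⨾ᵛ joinᵛ A′ B′)

⊕-monoˡ : ∀ {A A′} B → A ↪ A′ → A ⊕ B ↪ A′ ⊕ B
⊕-monoˡ B f = ⊕-mono f (↪-refl {B})

⊕-monoʳ : ∀ A {B B′} → B ↪ B′ → A ⊕ B ↪ A ⊕ B′
⊕-monoʳ A g = ⊕-mono (↪-refl {A}) g

⊕-swap : ∀ A B → A ⊕ B ↪ B ⊕ A
⊕-swap A B = unrooted→↪ (splitᵛ A B ⨾ᵛ ⊎ᵛ-swap ⨾ᵛ joinᵛ B A)

⊕-assocʳ : ∀ A B C → A ⊕ B ⊕ C ↪ A ⊕ (B ⊕ C)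
⊕-assocʳ A B C = unrooted→↪
  (splitᵛ (A ⊕ B) C ⨾ᵛ ⊎ᵛ-mono (splitᵛ A B) ⊑-refl ⨾ᵛ ⊎ᵛ-assocʳ
    ⨾ᵛ ⊎ᵛ-mono ⊑-refl (joinᵛ B C) ⨾ᵛ joinᵛ A (B ⊕ C))

⊕-assocˡ : ∀ A B C → A ⊕ (B ⊕ C) ↪ A ⊕ B ⊕ C
⊕-assocˡ A B C = ⊕-swap A (B ⊕ C) ⨾ ⊕-monoˡ A (⊕-swap B C) ⨾ ⊕-assocʳ C B A
  ⨾ ⊕-swap C (B ⊕ A) ⨾ ⊕-monoˡ C (⊕-swap B A)

⊕-inl : ∀ A B → A ↪ A ⊕ B
⊕-inl A B = unrooted→↪ (mk⊑ inj₁ SumP.inj₁-injective (λ _ _ → refl) (λ _ → refl) ⨾ᵛ joinᵛ A B)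

⊕-inr : ∀ A B → B ↪ A ⊕ B
⊕-inr A B = ⊕-inl B A ⨾ ⊕-swap B A

⊕-K0 : ∀ A → A ⊕ K0 ↪ A
⊕-K0 A = unrooted→↪ (splitᵛ A K0 ⨾ᵛ mk⊑ (λ { (inj₁ x) → x })
  (λ { {inj₁ _} {inj₁ _} refl → refl }) (λ { (inj₁ _) (inj₁ _) → refl }) λ _ → refl)

⊕-exchange : ∀ A B C → A ⊕ (B ⊕ C) ↪ B ⊕ (A ⊕ C)
⊕-exchange A B C = ⊕-assocˡ A B C ⨾ ⊕-monoˡ C (⊕-swap A B) ⨾ ⊕-assocʳ B A C

⊕-cong : ∀ {A A′ B B′} → A ~ A′ → B ~ B′ → A ⊕ B ~ A′ ⊕ B′
⊕-cong (f ⇄ f′) (g ⇄ g′) = ⊕-mono f g ⇄ ⊕-mono f′ g′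

-- Spiders, leg by leg

infixl 6 _◁_
-- The roots remain those of `X`, so successive legs meet in one centre and can be exchanged.
_◁_ : RootedGraph → ℕ → RootedGraph
X ◁ l = record { V = V X ⊎ Fin l ; adjᵛ = a ; root = [ root X , (λ _ → false) ]′ }
  where
  a : V X ⊎ Fin l → V X ⊎ Fin l → Bool
  a (inj₁ x) (inj₁ y) = adjᵛ X x y
  a (inj₂ x) (inj₂ y) = Adj (P l) x y
  a (inj₁ x) (inj₂ y) = root X x ∧ (toℕ y ≡ᵇ 0)
  a (inj₂ x) (inj₁ y) = root X y ∧ (toℕ x ≡ᵇ 0)

0<spiderSize : ∀ ls → (spiderSize ls ≡ᵇ 0) ≡ false
0<spiderSize []       = refl
0<spiderSize (l ∷ ls) with spiderSize ls | 0<spiderSize ls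
... | suc _ | _ = refl

joinLeg : ∀ l ls → (rooted (spider ls) ◁ l) ⊑ rooted (spider (l ∷ ls))
joinLeg l ls = mk⊑ (join m l) j-inj pres roots
  where
  m = spiderSize ls
  j-inj : Injective _≡_ _≡_ (join m l)
  j-inj {x} {y} e = trans (sym (FP.splitAt-join m l x)) (trans (cong (splitAt m) e) (FP.splitAt-join m l y))
  cross : ∀ x y → (x ↑ˡ l) ≢ (m ↑ʳ y)
  cross x y e = case j-inj {inj₁ x} {inj₂ y} e of λ ()
  pres : ∀ x y → adjᵛ (rooted (spider ls) ◁ l) x y ≡ Adj (spider (l ∷ ls)) (join m l x) (join m l y)
  pres (inj₁ x) (inj₁ y)
    rewrite FP.splitAt-↑ˡ m x l | FP.splitAt-↑ˡ m y l | ≟-inj (_↑ˡ l) (FP.↑ˡ-injective l _ _) x y = refl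
  pres (inj₂ x) (inj₂ y)
    rewrite FP.splitAt-↑ʳ m l x | FP.splitAt-↑ʳ m l y | ≟-inj (m ↑ʳ_) (FP.↑ʳ-injective m _ _) x y = refl
  pres (inj₁ x) (inj₂ y)
    rewrite FP.splitAt-↑ˡ m x l | FP.splitAt-↑ʳ m l y | ≟-≢ (cross x y) = sym (∨-identityʳ _)
  pres (inj₂ x) (inj₁ y)
    rewrite FP.splitAt-↑ʳ m l x | FP.splitAt-↑ˡ m y l | ≟-≢ (cross y x ∘ sym) = refl
  roots : ∀ x → root (rooted (spider ls) ◁ l) x ≡ (toℕ (join m l x) ≡ᵇ 0)
  roots (inj₁ x) = cong (_≡ᵇ 0) (sym (FP.toℕ-↑ˡ x l))
  roots (inj₂ y) = sym (trans (cong (_≡ᵇ 0) (FP.toℕ-↑ʳ m y)) (lem m (0<spiderSize ls)))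
    where
    lem : ∀ m → (m ≡ᵇ 0) ≡ false → (m + toℕ y ≡ᵇ 0) ≡ false
    lem (suc m) _ = refl

splitLeg : ∀ l ls → rooted (spider (l ∷ ls)) ⊑ (rooted (spider ls) ◁ l)
splitLeg l ls = inverseᵛ (joinLeg l ls) (splitAt (spiderSize ls)) (FP.join-splitAt (spiderSize ls) l)

P-mono : ∀ {k l} → k ≤ l → P k ↪ P l
P-mono k≤l = mk↪ (λ x → inject≤ x k≤l) inj′ λ x y →
  cong₂ _∧_ (cong not (sym (≟-inj (λ z → inject≤ z k≤l) inj′ x y)))
    (cong₂ (λ a b → (b ≡ᵇ suc a) ∨ (a ≡ᵇ suc b))
      (sym (FP.toℕ-inject≤ x k≤l)) (sym (FP.toℕ-inject≤ y k≤l)))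
  where
  inj′ : Injective _≡_ _≡_ (λ x → inject≤ x k≤l)
  inj′ = FP.inject≤-injective k≤l k≤l _ _

◁-mono : ∀ {X Y k l} → X ⊑ Y → k ≤ l → (X ◁ k) ⊑ (Y ◁ l)
◁-mono (mk⊑ f i a r) k≤l = mk⊑ (Sum.map f g) (⊎-injective i (inj (P-mono k≤l)))
  (λ { (inj₁ x) (inj₁ y) → a x y ; (inj₁ x) (inj₂ y) → cross x y
     ; (inj₂ x) (inj₁ y) → cross y x ; (inj₂ x) (inj₂ y) → adj (P-mono k≤l) x y })
  λ { (inj₁ x) → r x ; (inj₂ _) → refl }
  where
  g = fun (P-mono k≤l)
  cross : ∀ x y → _ ≡ _
  cross x y = cong₂ _∧_ (r x) (cong (_≡ᵇ 0) (sym (FP.toℕ-inject≤ y k≤l)))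

◁-exchange : ∀ {X k l} → (X ◁ k ◁ l) ⊑ (X ◁ l ◁ k)
◁-exchange = mk⊑
  (λ { (inj₁ (inj₁ x)) → inj₁ (inj₁ x) ; (inj₁ (inj₂ y)) → inj₂ y ; (inj₂ z) → inj₁ (inj₂ z) })
  (λ { {inj₁ (inj₁ _)} {inj₁ (inj₁ _)} refl → refl
     ; {inj₁ (inj₂ _)} {inj₁ (inj₂ _)} refl → refl
     ; {inj₂ _} {inj₂ _} refl → refl
     ; {inj₁ (inj₁ _)} {inj₁ (inj₂ _)} () ; {inj₁ (inj₁ _)} {inj₂ _} ()
     ; {inj₁ (inj₂ _)} {inj₁ (inj₁ _)} () ; {inj₁ (inj₂ _)} {inj₂ _} ()
     ; {inj₂ _} {inj₁ (inj₁ _)} () ; {inj₂ _} {inj₁ (inj₂ _)} () })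
  (λ { (inj₁ (inj₁ _)) (inj₁ (inj₁ _)) → refl ; (inj₁ (inj₁ _)) (inj₁ (inj₂ _)) → refl
     ; (inj₁ (inj₁ _)) (inj₂ _) → refl ; (inj₁ (inj₂ _)) (inj₁ (inj₁ _)) → refl
     ; (inj₁ (inj₂ _)) (inj₁ (inj₂ _)) → refl ; (inj₁ (inj₂ _)) (inj₂ _) → refl
     ; (inj₂ _) (inj₁ (inj₁ _)) → refl ; (inj₂ _) (inj₁ (inj₂ _)) → refl
     ; (inj₂ _) (inj₂ _) → refl })
  λ { (inj₁ (inj₁ _)) → refl ; (inj₁ (inj₂ _)) → refl ; (inj₂ _) → refl }

◁-inj₁ : ∀ {X l} → X ⊑ (X ◁ l)
◁-inj₁ = mk⊑ inj₁ SumP.inj₁-injective (λ _ _ → refl) λ _ → refl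

infix 4 _≲_ _≼_
infixr 5 _∷_

-- Preserving the centre makes this order stable under adding a leg. A bare embedding of spiders may
-- move the centre, for instance along a path.
record _≲_ (ks ls : List ℕ) : Set where
  constructor ⟨_⟩
  field rootedEmbedding : rooted (spider ks) ⊑ rooted (spider ls)
open _≲_

≲→↪ : ∀ {ks ls} → ks ≲ ls → spider ks ↪ spider ls
≲→↪ ⟨ f ⟩ = rooted→↪ f

≲-refl : ∀ {ls} → ls ≲ ls
≲-refl = ⟨ ⊑-refl ⟩

≲-trans : ∀ {js ks ls} → js ≲ ks → ks ≲ ls → js ≲ ls
≲-trans ⟨ f ⟩ ⟨ g ⟩ = ⟨ f ⨾ᵛ g ⟩

≲-cons : ∀ {k l ks ls} → k ≤ l → ks ≲ ls → k ∷ ks ≲ l ∷ ls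
≲-cons {k} {l} {ks} {ls} p ⟨ f ⟩ = ⟨ splitLeg k ks ⨾ᵛ ◁-mono f p ⨾ᵛ joinLeg l ls ⟩

≲-skip : ∀ {l ls} → ls ≲ l ∷ ls
≲-skip {l} {ls} = ⟨ ◁-inj₁ ⨾ᵛ joinLeg l ls ⟩

data _≼_ : List ℕ → List ℕ → Set where
  []   : ∀ {ls} → [] ≼ ls
  _∷_  : ∀ {k l ks ls} → k ≤ l → ks ≼ ls → k ∷ ks ≼ l ∷ ls

≼-refl : ∀ {ls} → ls ≼ ls
≼-refl {[]}    = []
≼-refl {_ ∷ _} = NP.≤-refl ∷ ≼-refl

≼→≲ : ∀ {ks ls} → ks ≼ ls → ks ≲ ls
≼→≲ {ls = []}    []      = ≲-refl
≼→≲ {ls = _ ∷ _} []      = ≲-trans (≼→≲ []) ≲-skip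
≼→≲              (p ∷ q) = ≲-cons p (≼→≲ q)

spider-mono : ∀ ks ls → ks ≼ ls → spider ks ↪ spider ls
spider-mono _ _ p = ≲→↪ (≼→≲ p)

↭→≲ : ∀ {ks ls} → ks ↭ ls → ks ≲ ls
↭→≲ Perm.refl         = ≲-refl
↭→≲ (Perm.prep x p)   = ≲-cons NP.≤-refl (↭→≲ p)
↭→≲ {_ ∷ _ ∷ ks} {_ ∷ _ ∷ ls} (Perm.swap x y p) = ≲-trans (≲-cons NP.≤-refl (≲-cons NP.≤-refl (↭→≲ p)))
  ⟨ splitLeg x (y ∷ ls) ⨾ᵛ ◁-mono (splitLeg y ls) NP.≤-refl ⨾ᵛ ◁-exchange
    ⨾ᵛ ◁-mono (joinLeg x ls) NP.≤-refl ⨾ᵛ joinLeg y (x ∷ ls) ⟩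
↭→≲ (Perm.trans p q)  = ≲-trans (↭→≲ p) (↭→≲ q)

emptyLeg : ∀ {ls} → 0 ∷ ls ≲ ls
emptyLeg {ls} = ⟨ splitLeg 0 ls ⨾ᵛ mk⊑ (λ { (inj₁ x) → x }) (λ { {inj₁ _} {inj₁ _} refl → refl })
  (λ { (inj₁ _) (inj₁ _) → refl }) (λ { (inj₁ _) → refl }) ⟩

-- Deleting the first vertex of a leg separates the rest of the leg.
cutLeg : ∀ l ls → spider ls ⊕ P l ↪ spider (suc l ∷ ls)
cutLeg l ls = mk↪ funᵛ′ injᵛ′ presᵛ′
  where
  mid : RootedGraph
  mid = rooted (spider ls) ◁ suc l
  f : (unrooted (spider ls) ⊎ᵛ unrooted (P l)) ⊑ record mid { root = λ _ → false }
  f = mk⊑ (Sum.map id suc) (⊎-injective id FP.suc-injective)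
    (λ { (inj₁ _) (inj₁ _) → refl ; (inj₁ _) (inj₂ _) → sym (∧-zeroʳ _)
       ; (inj₂ _) (inj₁ _) → sym (∧-zeroʳ _)
       ; (inj₂ x) (inj₂ y) → cong (λ z → not z ∧ (rel (P l) x y ∨ rel (P l) y x)) (sym (≟-inj suc FP.suc-injective x y)) })
    λ _ → refl
  g = joinLeg (suc l) ls
  s = splitᵛ (spider ls) (P l)
  funᵛ′ = funᵛ g ∘ funᵛ f ∘ funᵛ s
  injᵛ′ : Injective _≡_ _≡_ funᵛ′
  injᵛ′ = injᵛ s ∘ injᵛ f ∘ injᵛ g
  presᵛ′ : ∀ i j → Adj (spider ls ⊕ P l) i j ≡ Adj (spider (suc l ∷ ls)) (funᵛ′ i) (funᵛ′ j)
  presᵛ′ i j = trans (presᵛ s i j) (trans (presᵛ f (funᵛ s i) (funᵛ s j)) (presᵛ g (funᵛ f (funᵛ s i)) (funᵛ f (funᵛ s j))))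

-- Preserving roots forces the image to miss the centre.
leaves : ∀ b → unrooted (copies b (P 1)) ⊑ rooted (spider (replicate b 1))
leaves zero    = mk⊑ (λ ()) (λ { {()} }) (λ ()) (λ ())
leaves (suc b) = splitᵛ (P 1) (copies b (P 1)) ⨾ᵛ
  mk⊑ (λ { (inj₁ x) → inj₂ x ; (inj₂ y) → inj₁ (funᵛ (leaves b) y) })
  (λ { {inj₁ _} {inj₁ _} refl → refl
     ; {inj₂ x} {inj₂ y} e → cong inj₂ (injᵛ (leaves b) (SumP.inj₁-injective e)) })
  (λ { (inj₁ _) (inj₁ _) → refl
     ; (inj₁ x) (inj₂ y) → cong (_∧ (toℕ x ≡ᵇ 0)) (rootᵛ (leaves b) y)
     ; (inj₂ y) (inj₁ x) → cong (_∧ (toℕ x ≡ᵇ 0)) (rootᵛ (leaves b) y)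
     ; (inj₂ x) (inj₂ y) → presᵛ (leaves b) x y })
  (λ { (inj₁ _) → refl ; (inj₂ y) → rootᵛ (leaves b) y })
  ⨾ᵛ joinLeg 1 (replicate b 1)

-- Path star forests that avoid the four graphs of (G3)

data Obstructed (F : Graph) : Set where
  has2P₁+2P₂ : copies 2 (P 1) ⊕ copies 2 (P 2) ↪ F → Obstructed F
  hasP₁+2P₃  : P 1 ⊕ copies 2 (P 3) ↪ F → Obstructed F
  has2P₁+P₄  : copies 2 (P 1) ⊕ P 4 ↪ F → Obstructed F
  has3P₂     : copies 3 (P 2) ↪ F → Obstructed F

obstructed-mono : ∀ {F G} → Obstructed F → F ↪ G → Obstructed G
obstructed-mono (has2P₁+2P₂ e) f = has2P₁+2P₂ (e ⨾ f)
obstructed-mono (hasP₁+2P₃ e)  f = hasP₁+2P₃ (e ⨾ f)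
obstructed-mono (has2P₁+P₄ e)  f = has2P₁+P₄ (e ⨾ f)
obstructed-mono (has3P₂ e)     f = has3P₂ (e ⨾ f)

-- The offsets make every value of the parameters a legitimate shape.
data Component : Set where
  star star⁺ star⁺⁺ : ℕ → Component
  p5 p6 p7 s122 s123 : Component

⟦_⟧ : Component → Graph
⟦ star s ⟧   = Star1 (1 + s)
⟦ star⁺ s ⟧  = Star1⁺ (2 + s)
⟦ star⁺⁺ s ⟧ = Star1⁺⁺ (3 + s)
⟦ p5 ⟧       = P 5
⟦ p6 ⟧       = P 6
⟦ p7 ⟧       = P 7
⟦ s122 ⟧     = S 1 2 2
⟦ s123 ⟧     = S 1 2 3

data ComponentView (ls : List ℕ) : Set where
  trivial    : spider ls ~ P 1 → ComponentView ls
  component  : ∀ c → spider ls ~ ⟦ c ⟧ → ComponentView ls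
  obstructed : Obstructed (spider ls) → ComponentView ls

componentView-resp : ∀ {ks ls} → ks ≲ ls → ls ≲ ks → ComponentView ls → ComponentView ks
componentView-resp f g (trivial p)     = trivial (~-trans (≲→↪ f ⇄ ≲→↪ g) p)
componentView-resp f g (component c p) = component c (~-trans (≲→↪ f ⇄ ≲→↪ g) p)
componentView-resp f g (obstructed o)  = obstructed (obstructed-mono o (≲→↪ g))

legs : List ℕ → ℕ → List ℕ
legs ks b = map (2 +_) ks ++ replicate b 1

-- Only legs of length at least 2 distinguish the cases of the classification. They are kept with
-- offset 2; legs of length 1 are merely counted, and those of length 0, which the encoding admits,
-- vanish.
sortLegs : ∀ ls → Σ (List ℕ) λ ks → Σ ℕ λ b → ls ≲ legs ks b × legs ks b ≲ ls
sortLegs [] = [] , 0 , ≲-refl , ≲-refl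
sortLegs (l ∷ ls) with sortLegs ls
sortLegs (0 ∷ ls)           | ks , b , f , g = ks , b , ≲-trans emptyLeg f , ≲-trans g ≲-skip
sortLegs (1 ∷ ls)           | ks , b , f , g =
  ks , suc b , ≲-trans (≲-cons NP.≤-refl f) (↭→≲ (↭-sym σ)) , ≲-trans (↭→≲ σ) (≲-cons NP.≤-refl g)
  where
  σ : legs ks (suc b) ↭ 1 ∷ legs ks b
  σ = shift 1 (map (2 +_) ks) (replicate b 1)
sortLegs (suc (suc l) ∷ ls) | ks , b , f , g =
  l ∷ ks , b , ≲-cons NP.≤-refl f , ≲-cons NP.≤-refl g

obstructedBy : ∀ ks {ls} → Obstructed (spider ks) → ks ≼ ls → ComponentView ls
obstructedBy ks {ls} o p = obstructed (obstructed-mono o (spider-mono ks ls p))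

private
  infix 6 _⁺≤_
  _⁺≤_ : ∀ k l → k ≤ k + l
  _⁺≤_ = NP.m≤m+n

-- Deleting the centre turns the legs into components. Three legs of length at least 2 leave 3P₂,
-- two such legs with two leaves 2P₁+2P₂, legs of length at least 3, 3 and 1 P₁+2P₃, and a leg of
-- length at least 4 with two further legs 2P₁+P₄. A spider with at most two legs is a path, and P₈
-- contains 3P₂. The same path occurs several times because any of its vertices may be the centre.
legsView : ∀ ks b → ComponentView (legs ks b)
legsView [] zero    = trivial (emb! ⇄ emb!)
legsView [] (suc b) = component (star b) ~-refl
legsView (0 ∷ []) 0 = component (star 1) (emb! ⇄ emb!)
legsView (1 ∷ []) 0 = component (star⁺ 0) (emb! ⇄ emb!)
legsView (2 ∷ []) 0 = component p5 (emb! ⇄ emb!)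
legsView (3 ∷ []) 0 = component p6 (emb! ⇄ emb!)
legsView (4 ∷ []) 0 = component p7 (emb! ⇄ emb!)
legsView (suc (suc (suc (suc (suc k)))) ∷ []) 0 =
  obstructedBy (7 ∷ []) (has3P₂ emb!) (7 ⁺≤ k ∷ [])
legsView (0 ∷ []) 1 = component (star⁺ 0) ~-refl
legsView (1 ∷ []) 1 = component p5 (emb! ⇄ emb!)
legsView (2 ∷ []) 1 = component p6 (emb! ⇄ emb!)
legsView (3 ∷ []) 1 = component p7 (emb! ⇄ emb!)
legsView (suc (suc (suc (suc k))) ∷ []) 1 =
  obstructedBy (6 ∷ 1 ∷ []) (has3P₂ emb!) (6 ⁺≤ k ∷ 1 ⁺≤ 0 ∷ [])
legsView (0 ∷ []) (suc (suc b)) = component (star⁺ (suc b)) ~-refl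
legsView (1 ∷ []) (suc (suc b)) = component (star⁺⁺ b) ~-refl
legsView (suc (suc k) ∷ []) (suc (suc b)) =
  obstructedBy (4 ∷ 1 ∷ 1 ∷ []) (has2P₁+P₄ emb!) (4 ⁺≤ k ∷ 1 ⁺≤ 0 ∷ 1 ⁺≤ 0 ∷ [])
legsView (0 ∷ 0 ∷ []) 0 = component p5 (emb! ⇄ emb!)
legsView (0 ∷ 1 ∷ []) 0 = component p6 (emb! ⇄ emb!)
legsView (1 ∷ 0 ∷ []) 0 = component p6 (emb! ⇄ emb!)
legsView (0 ∷ 2 ∷ []) 0 = component p7 (emb! ⇄ emb!)
legsView (1 ∷ 1 ∷ []) 0 = component p7 (emb! ⇄ emb!)
legsView (2 ∷ 0 ∷ []) 0 = component p7 (emb! ⇄ emb!)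
legsView (0 ∷ suc (suc (suc l)) ∷ []) 0 = obstructedBy (2 ∷ 5 ∷ []) (has3P₂ emb!) (2 ⁺≤ 0 ∷ 5 ⁺≤ l ∷ [])
legsView (1 ∷ suc (suc l) ∷ []) 0 = obstructedBy (3 ∷ 4 ∷ []) (has3P₂ emb!) (3 ⁺≤ 0 ∷ 4 ⁺≤ l ∷ [])
legsView (2 ∷ suc l ∷ []) 0 = obstructedBy (4 ∷ 3 ∷ []) (has3P₂ emb!) (4 ⁺≤ 0 ∷ 3 ⁺≤ l ∷ [])
legsView (suc (suc (suc k)) ∷ l ∷ []) 0 = obstructedBy (5 ∷ 2 ∷ []) (has3P₂ emb!) (5 ⁺≤ k ∷ 2 ⁺≤ l ∷ [])
legsView (0 ∷ 0 ∷ []) 1 = component s122 (emb! ⇄ emb!)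
legsView (0 ∷ 1 ∷ []) 1 = component s123 (emb! ⇄ emb!)
legsView (1 ∷ 0 ∷ []) 1 = component s123 (emb! ⇄ emb!)
legsView (0 ∷ suc (suc l) ∷ []) 1 =
  obstructedBy (2 ∷ 4 ∷ 1 ∷ []) (has2P₁+P₄ emb!) (2 ⁺≤ 0 ∷ 4 ⁺≤ l ∷ 1 ⁺≤ 0 ∷ [])
legsView (suc (suc k) ∷ 0 ∷ []) 1 =
  obstructedBy (4 ∷ 2 ∷ 1 ∷ []) (has2P₁+P₄ emb!) (4 ⁺≤ k ∷ 2 ⁺≤ 0 ∷ 1 ⁺≤ 0 ∷ [])
legsView (suc k ∷ suc l ∷ []) 1 =
  obstructedBy (3 ∷ 3 ∷ 1 ∷ []) (hasP₁+2P₃ emb!) (3 ⁺≤ k ∷ 3 ⁺≤ l ∷ 1 ⁺≤ 0 ∷ [])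
legsView (k ∷ l ∷ []) (suc (suc b)) =
  obstructedBy (2 ∷ 2 ∷ 1 ∷ 1 ∷ []) (has2P₁+2P₂ emb!) (2 ⁺≤ k ∷ 2 ⁺≤ l ∷ 1 ⁺≤ 0 ∷ 1 ⁺≤ 0 ∷ [])
legsView (k ∷ l ∷ m ∷ ks) b =
  obstructedBy (2 ∷ 2 ∷ 2 ∷ []) (has3P₂ emb!) (2 ⁺≤ k ∷ 2 ⁺≤ l ∷ 2 ⁺≤ m ∷ [])

spiderView : ∀ ls → ComponentView ls
spiderView ls with ks , b , f , g ← sortLegs ls =
  componentView-resp f g (legsView ks b)

components : List Component → Graph
components []       = K0
components (c ∷ cs) = ⟦ c ⟧ ⊕ components cs

gather : ∀ lss → Obstructed (spiders lss) ⊎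
  (Σ ℕ λ a → Σ (List Component) λ cs → spiders lss ~ copies a (P 1) ⊕ components cs)
gather [] = inj₂ (0 , [] , emb! ⇄ emb!)
gather (ls ∷ lss) with spiderView ls | gather lss
... | obstructed o  | _ = inj₁ (obstructed-mono o (⊕-inl (spider ls) (spiders lss)))
... | _             | inj₁ o = inj₁ (obstructed-mono o (⊕-inr (spider ls) (spiders lss)))
... | trivial p     | inj₂ (a , cs , q) = inj₂ (suc a , cs , ~-trans (⊕-cong p q)
  (⊕-assocˡ (P 1) (copies a (P 1)) (components cs) ⇄ ⊕-assocʳ (P 1) (copies a (P 1)) (components cs)))
... | component c p | inj₂ (a , cs , q) = inj₂ (a , c ∷ cs , ~-trans (⊕-cong p q)
  (⊕-exchange ⟦ c ⟧ (copies a (P 1)) (components cs) ⇄ ⊕-exchange (copies a (P 1)) ⟦ c ⟧ (components cs)))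

-- Low shapes are 2P₂-free, high shapes contain 2P₂.
data Low : Set where
  isolated        : ℕ → Low
  isolated+star   : ℕ → ℕ → Low
  star⁺ P₁+star⁺  : ℕ → Low

data High : Set where
  star⁺⁺ P₁+star⁺⁺                : ℕ → High
  twoStars                        : ℕ → ℕ → High
  P₁+P₂+star                      : ℕ → High
  P₂+P₄ P₅ P₁+P₅ P₆ P₇ S₁₂₂ S₁₂₃  : High

low : Low → Graph
low (isolated a)        = copies a (P 1)
low (isolated+star a s) = copies a (P 1) ⊕ ⟦ star s ⟧
low (star⁺ s)           = ⟦ star⁺ s ⟧
low (P₁+star⁺ s)        = P 1 ⊕ ⟦ star⁺ s ⟧

high : High → Graph
high (star⁺⁺ s)     = ⟦ star⁺⁺ s ⟧
high (P₁+star⁺⁺ s)  = P 1 ⊕ ⟦ star⁺⁺ s ⟧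
high (twoStars s r) = ⟦ star s ⟧ ⊕ ⟦ star r ⟧
high (P₁+P₂+star s) = P 1 ⊕ P 2 ⊕ ⟦ star s ⟧
high P₂+P₄          = P 2 ⊕ P 4
high P₅             = P 5
high P₁+P₅          = P 1 ⊕ P 5
high P₆             = P 6
high P₇             = P 7
high S₁₂₂           = S 1 2 2
high S₁₂₃           = S 1 2 3

data Classified (F : Graph) : Set where
  obstructed : Obstructed F → Classified F
  isLow      : ∀ s → F ~ low s → Classified F
  isHigh     : ∀ s → F ~ high s → Classified F

classified-resp : ∀ {F G} → F ~ G → Classified G → Classified F
classified-resp e (obstructed o) = obstructed (obstructed-mono o (from e))
classified-resp e (isLow s p)    = isLow s (~-trans e p)
classified-resp e (isHigh s p)   = isHigh s (~-trans e p)

⊕-K0-~ : ∀ A → A ⊕ K0 ~ A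
⊕-K0-~ A = ⊕-K0 A ⇄ ⊕-inl A K0

K0-⊕-~ : ∀ A → K0 ⊕ A ~ A
K0-⊕-~ A = (⊕-swap K0 A ⨾ ⊕-K0 A) ⇄ ⊕-inr K0 A

⊕-swap-~ : ∀ A B → A ⊕ B ~ B ⊕ A
⊕-swap-~ A B = ⊕-swap A B ⇄ ⊕-swap B A

ones-≼ : ∀ {s t} → s ≤ t → replicate s 1 ≼ replicate t 1
ones-≼ z≤n     = []
ones-≼ (s≤s p) = NP.≤-refl ∷ ones-≼ p

star-mono : ∀ {s t} → s ≤ t → Star1 s ↪ Star1 t
star-mono {s} {t} p = spider-mono (replicate s 1) (replicate t 1) (ones-≼ p)

-- These are the components that contain P₄, and no star does. Beside two nonadjacent vertices
-- elsewhere they produce 2P₁+P₄.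
data NonStar : Component → Set where
  star⁺  : ∀ s → NonStar (star⁺ s)
  star⁺⁺ : ∀ s → NonStar (star⁺⁺ s)
  p5     : NonStar p5
  p6     : NonStar p6
  p7     : NonStar p7
  s122   : NonStar s122
  s123   : NonStar s123

star⁺-mono : ∀ s → spider (2 ∷ 1 ∷ []) ↪ ⟦ star⁺ s ⟧
star⁺-mono s = spider-mono (2 ∷ 1 ∷ []) (2 ∷ replicate (1 + s) 1) (NP.≤-refl ∷ NP.≤-refl ∷ [])

star⁺⁺-mono : ∀ s → spider (3 ∷ 1 ∷ 1 ∷ []) ↪ ⟦ star⁺⁺ s ⟧
star⁺⁺-mono s = spider-mono (3 ∷ 1 ∷ 1 ∷ []) (3 ∷ replicate (2 + s) 1) (NP.≤-refl ∷ NP.≤-refl ∷ NP.≤-refl ∷ [])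

P₂↪ : ∀ c → P 2 ↪ ⟦ c ⟧
P₂↪ (star s)   = emb! ⨾ star-mono (1 ⁺≤ s)
P₂↪ (star⁺ s)  = emb! ⨾ star⁺-mono s
P₂↪ (star⁺⁺ s) = emb! ⨾ star⁺⁺-mono s
P₂↪ p5   = emb!
P₂↪ p6   = emb!
P₂↪ p7   = emb!
P₂↪ s122 = emb!
P₂↪ s123 = emb!

P₄↪ : ∀ {c} → NonStar c → P 4 ↪ ⟦ c ⟧
P₄↪ (star⁺ s)  = emb! ⨾ star⁺-mono s
P₄↪ (star⁺⁺ s) = emb! ⨾ star⁺⁺-mono s
P₄↪ p5   = emb!
P₄↪ p6   = emb!
P₄↪ p7   = emb!
P₄↪ s122 = emb!
P₄↪ s123 = emb!

P₃↪star : ∀ s → P 3 ↪ ⟦ star (suc s) ⟧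
P₃↪star s = emb! ⨾ star-mono (2 ⁺≤ s)

starOrNot : ∀ c → (Σ ℕ λ s → c ≡ star s) ⊎ NonStar c
starOrNot (star s)   = inj₁ (s , refl)
starOrNot (star⁺ s)  = inj₂ (star⁺ s)
starOrNot (star⁺⁺ s) = inj₂ (star⁺⁺ s)
starOrNot p5   = inj₂ p5
starOrNot p6   = inj₂ p6
starOrNot p7   = inj₂ p7
starOrNot s122 = inj₂ s122
starOrNot s123 = inj₂ s123

K0-↪ : ∀ G → K0 ↪ G
K0-↪ G = mk↪ (λ ()) (λ { {()} }) (λ ())

copies₂-mono : ∀ a → copies 2 (P 1) ↪ copies (2 + a) (P 1)
copies₂-mono a = ⊕-monoʳ (P 1) (⊕-monoʳ (P 1) (K0-↪ (copies a (P 1))))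

withOne : ∀ a c → Classified (copies a (P 1) ⊕ ⟦ c ⟧)
withOne a (star s) = isLow (isolated+star a s) ~-refl
withOne 0 (star⁺ s)  = isLow (star⁺ s) (K0-⊕-~ ⟦ star⁺ s ⟧)
withOne 0 (star⁺⁺ s) = isHigh (star⁺⁺ s) (K0-⊕-~ ⟦ star⁺⁺ s ⟧)
withOne 0 p5   = isHigh P₅ (K0-⊕-~ (P 5))
withOne 0 p6   = isHigh P₆ (K0-⊕-~ (P 6))
withOne 0 p7   = isHigh P₇ (K0-⊕-~ (P 7))
withOne 0 s122 = isHigh S₁₂₂ (K0-⊕-~ (S 1 2 2))
withOne 0 s123 = isHigh S₁₂₃ (K0-⊕-~ (S 1 2 3))
withOne 1 c = classified-resp (⊕-cong (⊕-K0-~ (P 1)) (~-refl {⟦ c ⟧})) (go c)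
  where
  go : ∀ c → Classified (P 1 ⊕ ⟦ c ⟧)
  go (star s)   = isLow (isolated+star 1 s) (⊕-cong (~-sym (⊕-K0-~ (P 1))) (~-refl {⟦ star s ⟧}))
  go (star⁺ s)  = isLow (P₁+star⁺ s) ~-refl
  go (star⁺⁺ s) = isHigh (P₁+star⁺⁺ s) ~-refl
  go p5   = isHigh P₁+P₅ ~-refl
  go p6   = obstructed (has2P₁+P₄ emb!)
  go p7   = obstructed (has2P₁+P₄ emb!)
  go s122 = obstructed (has2P₁+2P₂ emb!)
  go s123 = obstructed (has2P₁+2P₂ emb!)
withOne (suc (suc a)) c with starOrNot c
... | inj₁ (s , refl) = isLow (isolated+star (2 + a) s) ~-refl
... | inj₂ ns         = obstructed (has2P₁+P₄ (⊕-mono (copies₂-mono a) (P₄↪ ns)))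

-- Beside a P₄, a second component that contains P₃ gives 2P₁+P₄, so it must be P₂. Next to P₂, K₁ₜ⁺
-- with t at least 3 yields 2P₁+2P₂, and every other non-star except P₄ contains 2P₂, hence yields
-- 3P₂. Only P₂+P₄ survives.
withNonStar : ∀ {c} → NonStar c → ∀ d → Classified (⟦ c ⟧ ⊕ ⟦ d ⟧)
withNonStar {c} nc d with starOrNot d
... | inj₂ nd = obstructed (has2P₁+P₄ (emb! {G = P 4 ⊕ P 4} ⨾ ⊕-mono (P₄↪ nc) (P₄↪ nd)))
... | inj₁ (suc s , refl) = obstructed (has2P₁+P₄ (emb! {G = P 4 ⊕ P 3} ⨾ ⊕-mono (P₄↪ nc) (P₃↪star s)))
... | inj₁ (zero , refl) with nc
...   | star⁺ zero    = isHigh P₂+P₄ (emb! ⇄ emb!)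
...   | star⁺ (suc s) = obstructed (has2P₁+2P₂ (emb! {G = spider (2 ∷ 1 ∷ 1 ∷ []) ⊕ Star1 1} ⨾
  ⊕-monoˡ (Star1 1) (spider-mono (2 ∷ 1 ∷ 1 ∷ []) (2 ∷ replicate (2 + s) 1) (NP.≤-refl ∷ NP.≤-refl ∷ NP.≤-refl ∷ []))))
...   | star⁺⁺ s = obstructed (has3P₂ (emb! {G = spider (3 ∷ 1 ∷ 1 ∷ []) ⊕ Star1 1} ⨾
  ⊕-monoˡ (Star1 1) (star⁺⁺-mono s)))
...   | p5   = obstructed (has3P₂ emb!)
...   | p6   = obstructed (has3P₂ emb!)
...   | p7   = obstructed (has3P₂ emb!)
...   | s122 = obstructed (has3P₂ emb!)
...   | s123 = obstructed (has3P₂ emb!)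

P₁+nonStar : ∀ {c} → NonStar c → ∀ d → Obstructed (P 1 ⊕ (⟦ c ⟧ ⊕ ⟦ d ⟧))
P₁+nonStar nc d = has2P₁+P₄ (emb! {G = P 1 ⊕ (P 4 ⊕ P 2)} ⨾ ⊕-monoʳ (P 1) (⊕-mono (P₄↪ nc) (P₂↪ d)))

-- Two isolated vertices and two edges already make 2P₁+2P₂. With a single isolated vertex both
-- components must be stars, and two copies of P₃ would make P₁+2P₃, so one star is P₂.
withTwo : ∀ a c d → Classified (copies a (P 1) ⊕ (⟦ c ⟧ ⊕ ⟦ d ⟧))
withTwo 0 c d = classified-resp (K0-⊕-~ (⟦ c ⟧ ⊕ ⟦ d ⟧)) go
  where
  go : Classified (⟦ c ⟧ ⊕ ⟦ d ⟧)
  go with starOrNot c | starOrNot d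
  ... | inj₁ (s , refl) | inj₁ (r , refl) = isHigh (twoStars s r) ~-refl
  ... | inj₂ nc         | _               = withNonStar nc d
  ... | _               | inj₂ nd         = classified-resp (⊕-swap-~ ⟦ c ⟧ ⟦ d ⟧) (withNonStar nd c)
withTwo 1 c d = classified-resp (⊕-cong (⊕-K0-~ (P 1)) (~-refl {⟦ c ⟧ ⊕ ⟦ d ⟧})) go
  where
  star₀ : ∀ s → P 1 ⊕ (⟦ star 0 ⟧ ⊕ ⟦ star s ⟧) ~ high (P₁+P₂+star s)
  star₀ s = ~-trans (⊕-cong (~-refl {P 1}) (⊕-cong {Star1 1} {P 2} (emb! ⇄ emb!) (~-refl {⟦ star s ⟧})))
    (⊕-assocˡ (P 1) (P 2) ⟦ star s ⟧ ⇄ ⊕-assocʳ (P 1) (P 2) ⟦ star s ⟧)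
  swapped : P 1 ⊕ (⟦ c ⟧ ⊕ ⟦ d ⟧) ~ P 1 ⊕ (⟦ d ⟧ ⊕ ⟦ c ⟧)
  swapped = ⊕-cong (~-refl {P 1}) (⊕-swap-~ ⟦ c ⟧ ⟦ d ⟧)
  go : Classified (P 1 ⊕ (⟦ c ⟧ ⊕ ⟦ d ⟧))
  go with starOrNot c | starOrNot d
  ... | inj₁ (0 , refl)     | inj₁ (r , refl)     = isHigh (P₁+P₂+star r) (star₀ r)
  ... | inj₁ (suc s , refl) | inj₁ (0 , refl)     = isHigh (P₁+P₂+star (suc s)) (~-trans swapped (star₀ (suc s)))
  ... | inj₁ (suc s , refl) | inj₁ (suc r , refl) = obstructed (hasP₁+2P₃
    (emb! {G = P 1 ⊕ (P 3 ⊕ P 3)} ⨾ ⊕-monoʳ (P 1) (⊕-mono (P₃↪star s) (P₃↪star r))))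
  ... | inj₂ nc | _       = obstructed (P₁+nonStar nc d)
  ... | _       | inj₂ nd = classified-resp swapped (obstructed (P₁+nonStar nd c))
withTwo (suc (suc a)) c d = obstructed (has2P₁+2P₂ (emb! {G = copies 2 (P 1) ⊕ (P 2 ⊕ P 2)} ⨾
  ⊕-mono (copies₂-mono a) (⊕-mono (P₂↪ c) (P₂↪ d))))

classify : ∀ lss → Classified (spiders lss)
classify lss with gather lss
... | inj₁ o = obstructed o
... | inj₂ (a , [] , e) = isLow (isolated a) (~-trans e (⊕-K0-~ (copies a (P 1))))
... | inj₂ (a , c ∷ [] , e) =
  classified-resp (~-trans e (⊕-cong (~-refl {copies a (P 1)}) (⊕-K0-~ ⟦ c ⟧))) (withOne a c)
... | inj₂ (a , c ∷ d ∷ [] , e) =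
  classified-resp (~-trans e (⊕-cong (~-refl {copies a (P 1)})
    (⊕-cong (~-refl {⟦ c ⟧}) (⊕-K0-~ ⟦ d ⟧)))) (withTwo a c d)
... | inj₂ (a , c ∷ d ∷ d′ ∷ cs , e) = obstructed (has3P₂
  (⊕-mono (P₂↪ c) (⊕-mono (P₂↪ d) (⊕-mono (P₂↪ d′) (K0-↪ (components cs))))
    ⨾ ⊕-inr (copies a (P 1)) (components (c ∷ d ∷ d′ ∷ cs)) ⨾ from e))

-- The six classes as explicit pairs

_↪?_ : ∀ H G → Dec (H ↪ G)
H ↪? G = map′ emb?-sound emb?-complete (emb? H G B.≟ true)

_~?_ : ∀ G H → Dec (G ~ H)
G ~? H = map′ (λ (f , g) → f ⇄ g) (λ (f ⇄ g) → f , g) ((G ↪? H) ×-dec (H ↪? G))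

-- The six pairs together with the two obtained by replacing K₃ by the paw.
data Base : Set where
  k3-p7 k3-s123 paw-p7 paw-s123 k4-s113 diamond-p123 diamond-p15 gem-p23 : Base

left right : Base → Graph
left k3-p7        = K 3
left k3-s123      = K 3
left paw-p7       = paw
left paw-s123     = paw
left k4-s113      = K 4
left diamond-p123 = diamond
left diamond-p15  = diamond
left gem-p23      = gem
right k3-p7        = P 7
right k3-s123      = S 1 2 3
right paw-p7       = P 7
right paw-s123     = S 1 2 3
right k4-s113      = S 1 1 3
right diamond-p123 = P 1 ⊕ P 2 ⊕ P 3
right diamond-p15  = P 1 ⊕ P 5
right gem-p23      = P 2 ⊕ P 3

-- Closes a base pair under swapping and complementing: up to order, the eight bases give the
-- sixteen pairs.
data Match (b : Base) (A B : Graph) : Set where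
  straight    : A ~ left b → B ~ right b → Match b A B
  crossed     : A ~ right b → B ~ left b → Match b A B
  co-straight : A ~ co (left b) → B ~ co (right b) → Match b A B
  co-crossed  : A ~ co (right b) → B ~ co (left b) → Match b A B

InSix : Pair → Set
InSix (A , B) = Σ Base λ b → Match b A B

match? : ∀ b A B → Dec (Match b A B)
match? b A B = map′
  [ (λ (p , q) → straight p q) , [ (λ (p , q) → crossed p q) ,
    [ (λ (p , q) → co-straight p q) , (λ (p , q) → co-crossed p q) ]′ ]′ ]′
  (λ { (straight p q) → inj₁ (p , q) ; (crossed p q) → inj₂ (inj₁ (p , q))
     ; (co-straight p q) → inj₂ (inj₂ (inj₁ (p , q))) ; (co-crossed p q) → inj₂ (inj₂ (inj₂ (p , q))) })
  (((A ~? left b) ×-dec (B ~? right b)) ⊎-dec (((A ~? right b) ×-dec (B ~? left b)) ⊎-dec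
    (((A ~? co (left b)) ×-dec (B ~? co (right b))) ⊎-dec ((A ~? co (right b)) ×-dec (B ~? co (left b))))))

inSix? : ∀ p → Dec (InSix p)
inSix? (A , B) = map′ (λ a → let b , _ , m = find a in b , m) (λ (b , m) → lose (listed b) m)
  (any? (λ b → match? b A B) bases)
  where
  bases : List Base
  bases = k3-p7 ∷ k3-s123 ∷ paw-p7 ∷ paw-s123 ∷ k4-s113 ∷ diamond-p123 ∷ diamond-p15 ∷ gem-p23 ∷ []
  listed : ∀ b → b ∈ bases
  listed k3-p7        = here refl
  listed k3-s123      = there (here refl)
  listed paw-p7       = there (there (here refl))
  listed paw-s123     = there (there (there (here refl)))
  listed k4-s113      = there (there (there (there (here refl))))
  listed diamond-p123 = there (there (there (there (there (here refl)))))
  listed diamond-p15  = there (there (there (there (there (there (here refl))))))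
  listed gem-p23      = there (there (there (there (there (there (there (here refl)))))))

inSix-resp : ∀ {A B A′ B′} → A ~ A′ → B ~ B′ → InSix (A′ , B′) → InSix (A , B)
inSix-resp f g (b , straight p q)    = b , straight (~-trans f p) (~-trans g q)
inSix-resp f g (b , crossed p q)     = b , crossed (~-trans f p) (~-trans g q)
inSix-resp f g (b , co-straight p q) = b , co-straight (~-trans f p) (~-trans g q)
inSix-resp f g (b , co-crossed p q)  = b , co-crossed (~-trans f p) (~-trans g q)

inSix-swap : ∀ {A B} → InSix (A , B) → InSix (B , A)
inSix-swap (b , straight p q)    = b , crossed q p
inSix-swap (b , crossed p q)     = b , straight q p
inSix-swap (b , co-straight p q) = b , co-crossed q p
inSix-swap (b , co-crossed p q)  = b , co-straight q p

inSix-co : ∀ {A B} → InSix (A , B) → InSix (co A , co B)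
inSix-co (b , straight p q)    = b , co-straight (co-~ p) (co-~ q)
inSix-co (b , crossed p q)     = b , co-crossed (co-~ p) (co-~ q)
inSix-co (b , co-straight p q) = b , straight (~-trans (co-~ p) (co-co (left b))) (~-trans (co-~ q) (co-co (right b)))
inSix-co (b , co-crossed p q)  = b , crossed (~-trans (co-~ p) (co-co (right b))) (~-trans (co-~ q) (co-co (left b)))

-- Replacing K₃ by the paw, or back, must not leave the sixteen pairs. It does not, since among all
-- graphs in them K₃ and the paw occur only as left members whose partner is P₇ or S₁₂₃.
record TriangleLike (A : Graph) : Set where
  field
    onLeft  : ∀ b → A ~ left b → right b ≡ P 7 ⊎ right b ≡ S 1 2 3
    onRight : ∀ b → ¬ A ~ right b
    onCoL   : ∀ b → ¬ A ~ co (left b)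
    onCoR   : ∀ b → ¬ A ~ co (right b)

partner : ∀ {A B} → TriangleLike A → InSix (A , B) → B ~ P 7 ⊎ B ~ S 1 2 3
partner {B = B} t (b , straight p q) with TriangleLike.onLeft t b p
... | inj₁ e = inj₁ (subst (B ~_) e q)
... | inj₂ e = inj₂ (subst (B ~_) e q)
partner t (b , crossed p q)     = ⊥-elim (TriangleLike.onRight t b p)
partner t (b , co-straight p q) = ⊥-elim (TriangleLike.onCoL t b p)
partner t (b , co-crossed p q)  = ⊥-elim (TriangleLike.onCoR t b p)

module _ {A : Graph} where
  private
    _≈?_ : Graph → Graph → Bool
    G ≈? H = emb? G H ∧ emb? H G
    apart : ∀ {G H} → (G ≈? H) ≡ false → ¬ G ~ H
    apart e (f ⇄ g) = case trans (sym e) (cong₂ _∧_ (emb?-complete f) (emb?-complete g)) of λ ()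

  triangleLike :
    (∀ b → (A ≈? left b) ≡ false ⊎ (right b ≡ P 7 ⊎ right b ≡ S 1 2 3)) →
    (∀ b → (A ≈? right b) ≡ false × (A ≈? co (left b)) ≡ false × (A ≈? co (right b)) ≡ false) →
    TriangleLike A
  triangleLike l r = record
    { onLeft  = λ b p → case l b of λ { (inj₁ e) → ⊥-elim (apart e p) ; (inj₂ q) → q }
    ; onRight = λ b → apart (proj₁ (r b))
    ; onCoL   = λ b → apart (proj₁ (proj₂ (r b)))
    ; onCoR   = λ b → apart (proj₂ (proj₂ (r b)))
    }

triangleLike-K₃ : TriangleLike (K 3)
triangleLike-K₃ = triangleLike
  (λ { k3-p7 → inj₂ (inj₁ refl) ; k3-s123 → inj₂ (inj₂ refl)
     ; paw-p7 → inj₁ refl ; paw-s123 → inj₁ refl ; k4-s113 → inj₁ refl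
     ; diamond-p123 → inj₁ refl ; diamond-p15 → inj₁ refl ; gem-p23 → inj₁ refl })
  (λ { k3-p7 → refl , refl , refl ; k3-s123 → refl , refl , refl
     ; paw-p7 → refl , refl , refl ; paw-s123 → refl , refl , refl ; k4-s113 → refl , refl , refl
     ; diamond-p123 → refl , refl , refl ; diamond-p15 → refl , refl , refl
     ; gem-p23 → refl , refl , refl })

triangleLike-paw : TriangleLike paw
triangleLike-paw = triangleLike
  (λ { paw-p7 → inj₂ (inj₁ refl) ; paw-s123 → inj₂ (inj₂ refl)
     ; k3-p7 → inj₁ refl ; k3-s123 → inj₁ refl ; k4-s113 → inj₁ refl
     ; diamond-p123 → inj₁ refl ; diamond-p15 → inj₁ refl ; gem-p23 → inj₁ refl })
  (λ { k3-p7 → refl , refl , refl ; k3-s123 → refl , refl , refl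
     ; paw-p7 → refl , refl , refl ; paw-s123 → refl , refl , refl ; k4-s113 → refl , refl , refl
     ; diamond-p123 → refl , refl , refl ; diamond-p15 → refl , refl , refl
     ; gem-p23 → refl , refl , refl })

inSix-K₃ : ∀ {B} → B ~ P 7 ⊎ B ~ S 1 2 3 → InSix (K 3 , B)
inSix-K₃ (inj₁ e) = k3-p7 , straight ~-refl e
inSix-K₃ (inj₂ e) = k3-s123 , straight ~-refl e

inSix-paw : ∀ {B} → B ~ P 7 ⊎ B ~ S 1 2 3 → InSix (paw , B)
inSix-paw (inj₁ e) = paw-p7 , straight ~-refl e
inSix-paw (inj₂ e) = paw-s123 , straight ~-refl e

inSix-step : ∀ {p q} → Step p q → InSix p → InSix q
inSix-step (iso {A} {B} {C} {D} f g) s = inSix-resp (~-sym (≅→~ {A} {C} f)) (~-sym (≅→~ {B} {D} g)) s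
inSix-step swap  s = inSix-swap s
inSix-step compl s = inSix-co s
inSix-step (k3→paw {A} {B} f) s =
  inSix-paw (partner triangleLike-K₃ (inSix-resp (~-sym (≅→~ {A} {K 3} f)) (~-refl {B}) s))
inSix-step (paw→k3 {A} {B} f) s =
  inSix-K₃ (partner triangleLike-paw (inSix-resp (~-sym (≅→~ {A} {paw} f)) (~-refl {B}) s))

-- `EquivClass` is only a reflexive transitive closure of directed steps. Invariance against their
-- direction takes the place of a proof that it is symmetric.
inSix-unstep : ∀ {p q} → Step p q → InSix q → InSix p
inSix-unstep (iso {A} {B} {C} {D} f g) s = inSix-resp (≅→~ {A} {C} f) (≅→~ {B} {D} g) s
inSix-unstep swap s = inSix-swap s
inSix-unstep (compl {A} {B}) s = inSix-resp (~-sym (co-co A)) (~-sym (co-co B)) (inSix-co s)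
inSix-unstep (k3→paw {A} {B} f) s =
  inSix-resp (≅→~ {A} {K 3} f) (~-refl {B}) (inSix-K₃ (partner triangleLike-paw s))
inSix-unstep (paw→k3 {A} {B} f) s =
  inSix-resp (≅→~ {A} {paw} f) (~-refl {B}) (inSix-paw (partner triangleLike-K₃ s))

inSix-class : ∀ {p q} → EquivClass p q → InSix p → InSix q
inSix-class ε        s = s
inSix-class (x ◅ xs) s = inSix-class xs (inSix-step x s)

inSix-unclass : ∀ {p q} → EquivClass p q → InSix q → InSix p
inSix-unclass ε        s = s
inSix-unclass (x ◅ xs) s = inSix-unstep x (inSix-unclass xs s)

sixPairs→inSix : ∀ {p} → SixPairs p → InSix p
sixPairs→inSix k3-p7        = k3-p7 , straight ~-refl ~-refl
sixPairs→inSix k3-s123      = k3-s123 , straight ~-refl ~-refl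
sixPairs→inSix k4-s113      = k4-s113 , straight ~-refl ~-refl
sixPairs→inSix diamond-p123 = diamond-p123 , straight ~-refl ~-refl
sixPairs→inSix diamond-p15  = diamond-p15 , straight ~-refl ~-refl
sixPairs→inSix gem-p23      = gem-p23 , straight ~-refl ~-refl

isoStep : ∀ {A B A′ B′} → A ~ A′ → B ~ B′ → EquivClass (A , B) (A′ , B′)
isoStep f g = iso (~→≅ f) (~→≅ g) ◅ ε

inSix→sixPairs : ∀ {p} → InSix p → Σ Pair λ q → SixPairs q × EquivClass p q
inSix→sixPairs (b , m) with base b
  where
  base : ∀ b → Σ Pair λ q → SixPairs q × EquivClass (left b , right b) q
  base k3-p7        = _ , k3-p7 , ε
  base k3-s123      = _ , k3-s123 , ε
  base paw-p7       = _ , k3-p7 , paw→k3 (~→≅ (~-refl {paw})) ◅ ε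
  base paw-s123     = _ , k3-s123 , paw→k3 (~→≅ (~-refl {paw})) ◅ ε
  base k4-s113      = _ , k4-s113 , ε
  base diamond-p123 = _ , diamond-p123 , ε
  base diamond-p15  = _ , diamond-p15 , ε
  base gem-p23      = _ , gem-p23 , ε
... | q , s , e = q , s , toBase m ◅◅ e
  where
  toBase : ∀ {A B} → Match b A B → EquivClass (A , B) (left b , right b)
  toBase (straight f g)    = isoStep f g
  toBase (crossed f g)     = swap ◅ isoStep g f
  toBase (co-straight f g) = compl ◅ isoStep (~-trans (co-~ f) (co-co (left b))) (~-trans (co-~ g) (co-co (right b)))
  toBase (co-crossed f g)  = swap ◅ compl ◅ isoStep (~-trans (co-~ g) (co-co (left b))) (~-trans (co-~ f) (co-co (right b)))

-- The conditions of the list, for pairs of forests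

pattern ⟪P1⟫ x = inj₁ x
pattern ⟪P2⟫ x = inj₂ (⟪P1⟫ x)
pattern ⟪P3⟫ x = inj₂ (⟪P2⟫ x)
pattern ⟪P4⟫ x = inj₂ (⟪P3⟫ x)
pattern ⟪P5⟫ x = inj₂ (⟪P4⟫ x)
pattern ⟪P6⟫ x = inj₂ (⟪P5⟫ x)
pattern ⟪P7⟫ x = inj₂ (⟪P6⟫ x)
pattern ⟪P8⟫ x = inj₂ (⟪P7⟫ x)
pattern ⟪G1⟫ x = inj₂ (⟪P8⟫ x)
pattern ⟪G2⟫ x = inj₂ (⟪G1⟫ x)
pattern ⟪G3⟫ x = inj₂ (⟪G2⟫ x)
pattern ⟪G4⟫ x = inj₂ (⟪G3⟫ x)
pattern ⟪G5⟫ x = inj₂ (⟪G4⟫ x)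
pattern ⟪G6⟫ x = inj₂ (⟪G5⟫ x)
pattern ⟪G7⟫ x = inj₂ (⟪G6⟫ x)
-- The last of sixteen summands: fifteen `inj₂` and no `inj₁`.
pattern ⟪G8⟫ x = inj₂ (inj₂ (inj₂ (inj₂ (inj₂ (inj₂ (inj₂ (inj₂ (inj₂ (inj₂ (inj₂ (inj₂ (inj₂ (inj₂ (inj₂ x))))))))))))))

EquivalentToListed : Pair → Set
EquivalentToListed p = Σ Graph λ H₁ → Σ Graph λ H₂ → Listed H₁ H₂ × EquivClass p (H₁ , H₂)

Settled : Pair → Set
Settled p = EquivalentToListed p ⊎ InSix p

-- The pair of forests (F , B) stands for the class of (co F , B)-free graphs.
record Out (F B : Graph) : Set where
  constructor out
  field settled : Settled (co F , B)
open Out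

settled-class : ∀ {p q} → EquivClass p q → Settled q → Settled p
settled-class e (inj₁ (H₁ , H₂ , l , e′)) = inj₁ (H₁ , H₂ , l , e ◅◅ e′)
settled-class e (inj₂ s)                  = inj₂ (inSix-unclass e s)

out-resp : ∀ {F B F′ B′} → F ~ F′ → B ~ B′ → Out F′ B′ → Out F B
out-resp f g (out s) = out (settled-class (isoStep (co-~ f) g) s)

-- Complementing `(co F , B)` and swapping gives `(co B , F)` up to isomorphism. The two forests
-- thus play symmetric roles, which halves the case analysis.
out-sym : ∀ {F B} → Out B F → Out F B
out-sym {F} {B} (out s) =
  out (settled-class (compl ◅ swap ◅ isoStep (~-refl {co B}) (co-co F)) s)

edgeless : ∀ t i j → Adj (copies t (P 1)) i j ≡ false
edgeless (suc t) i j = trans (_⊑_.presᵛ (splitᵛ (P 1) (copies t (P 1))) i j) (go (splitAt 1 i) (splitAt 1 j))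
  where
  go : ∀ x y → RootedGraph.adjᵛ (unrooted (P 1) ⊎ᵛ unrooted (copies t (P 1))) x y ≡ false
  go (inj₁ zero) (inj₁ zero) = refl
  go (inj₁ _)    (inj₂ _)    = refl
  go (inj₂ _)    (inj₁ _)    = refl
  go (inj₂ x)    (inj₂ y)    = edgeless t x y

co-copies : ∀ t → co (copies t (P 1)) ↪ K t
co-copies t = mk↪ (F.cast (size-copies t)) cast-inj λ i j →
  trans (Adj-co (copies t (P 1)) i j)
    (cong₂ (λ x y → not x ∧ y) (sym (≟-inj (F.cast (size-copies t)) cast-inj i j))
      (cong not (edgeless t i j)))
  where
  size-copies : ∀ t → size (copies t (P 1)) ≡ t
  size-copies zero    = refl
  size-copies (suc t) = cong suc (size-copies t)
  cast-inj : Injective _≡_ _≡_ (F.cast (size-copies t))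
  cast-inj {i} {j} e = FP.toℕ-injective (trans (sym (FP.toℕ-cast (size-copies t) i))
    (trans (cong F.toℕ e) (FP.toℕ-cast (size-copies t) j)))

data P4-target (B : Graph) (t : ℕ) : Set where
  in2K₁ₜ : B ↪ copies 2 (Star1 t) → P4-target B t
  inK₁ₜ⁺ : B ↪ Star1⁺ t → P4-target B t
  inP₅   : B ↪ P 5 → P4-target B t

data P5-target (B : Graph) : Set where
  inP₂+P₄    : B ↪ P 2 ⊕ P 4 → P5-target B
  inP₆       : B ↪ P 6 → P5-target B
  inS₁₂₂     : B ↪ S 1 2 2 → P5-target B
  inK₁ₜ⁺⁺+P₁ : ∀ t → B ↪ Star1⁺⁺ (suc t) ⊕ P 1 → P5-target B

data G4-target (B : Graph) : Set where
  hasK₁₄⁺⁺  : Star1⁺⁺ 4 ↪ B → G4-target B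
  hasP₁+2P₂ : P 1 ⊕ copies 2 (P 2) ↪ B → G4-target B
  hasP₁+P₄  : P 1 ⊕ P 4 ↪ B → G4-target B

data G6-target (B : Graph) : Set where
  hasK₁₃    : Star1 3 ↪ B → G6-target B
  has3P₁+P₂ : copies 3 (P 1) ⊕ P 2 ↪ B → G6-target B
  has2P₂    : copies 2 (P 2) ↪ B → G6-target B

data G7-target (B : Graph) : Set where
  hasK₁₃   : Star1 3 ↪ B → G7-target B
  hasP₂+P₄ : P 2 ⊕ P 4 ↪ B → G7-target B
  has2P₃   : copies 2 (P 3) ↪ B → G7-target B
  hasP₆    : P 6 ↪ B → G7-target B

-- With H₁ = `co F` each condition on H₁ is one on the forest `F`: K₃, K₄, K₅ become 3P₁, 4P₁, 5P₁,
-- C₄ becomes 2P₂, and the paw, the diamond and the gem become P₁+P₃, 2P₁+P₂ and P₁+P₄.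
module _ {F B : Graph} where
  private
    listed : Listed (co F) B → Out F B
    listed l = out (inj₁ (co F , B , l , ε))

  P1-rule : B ↪ P 4 → Out F B
  P1-rule g = listed (⟪P1⟫ (inj₂ (↪→⊆ g)))

  P2-rule : ∀ t → F ↪ Star1 (suc t) ⊕ P 1 → B ↪ Star1 (suc t) ⊕ P 1 → Out F B
  P2-rule t f g = listed (⟪P2⟫ (suc t , s≤s z≤n , ↪→⊆ (to (co-co F) ⨾ f) , ↪→⊆ g))

  P3-rule : ∀ t → F ↪ copies (suc t) (P 1) ⊕ P 3 → B ↪ copies (suc t) (P 1) ⊕ P 3 → Out F B
  P3-rule t f g = listed (⟪P3⟫ (suc t , s≤s z≤n , ↪→⊆ (to (co-co F) ⨾ f) , ↪→⊆ g))

  P4-rule : ∀ t → F ↪ copies (suc t) (P 1) → P4-target B (suc t) → Out F B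
  P4-rule t f g = listed (⟪P4⟫ (suc t , s≤s z≤n , ↪→⊆ (co-↪ f ⨾ co-copies (suc t)) , go g))
    where
    go : P4-target B (suc t) → _
    go (in2K₁ₜ g) = inj₁ (↪→⊆ g)
    go (inK₁ₜ⁺ g) = inj₂ (inj₁ (↪→⊆ g))
    go (inP₅ g)   = inj₂ (inj₂ (↪→⊆ g))

  P5-rule : F ↪ P 1 ⊕ P 3 → P5-target B → Out F B
  P5-rule f g = listed (⟪P5⟫ (↪→⊆ (co-↪ f) , go g))
    where
    go : P5-target B → _
    go (inP₂+P₄ g)      = inj₁ (↪→⊆ g)
    go (inP₆ g)         = inj₂ (inj₁ (↪→⊆ g))
    go (inS₁₂₂ g)       = inj₂ (inj₂ (inj₁ (↪→⊆ g)))
    go (inK₁ₜ⁺⁺+P₁ t g) = inj₂ (inj₂ (inj₂ (suc t , s≤s z≤n , ↪→⊆ g)))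

  P6-rule : F ↪ copies 2 (P 1) ⊕ P 2 → B ↪ P 1 ⊕ copies 2 (P 2) → Out F B
  P6-rule f g = listed (⟪P6⟫ (↪→⊆ (co-↪ f) , ↪→⊆ g))

  P7-rule : F ↪ P 1 ⊕ P 4 → B ↪ P 1 ⊕ P 4 ⊎ B ↪ P 5 → Out F B
  P7-rule f g = listed (⟪P7⟫ (↪→⊆ (co-↪ f) , [ inj₁ ∘ ↪→⊆ , inj₂ ∘ ↪→⊆ ]′ g))

  P8-rule : F ↪ copies 2 (P 1) ⊕ P 3 → B ↪ P 2 ⊕ P 3 ⊎ B ↪ P 5 → Out F B
  P8-rule f g = listed (⟪P8⟫ (↪→⊆ (co-↪ f) , [ inj₁ ∘ ↪→⊆ , inj₂ ∘ ↪→⊆ ]′ g))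

  G3-rule : copies 3 (P 1) ↪ F → Obstructed B → Out F B
  G3-rule f o = listed (⟪G3⟫ (↪→⊆ (emb! {H = K 3} ⨾ co-↪ f) , go o))
    where
    go : Obstructed B → _
    go (has2P₁+2P₂ g) = inj₁ (↪→⊆ g)
    go (hasP₁+2P₃ g)  = inj₂ (inj₁ (↪→⊆ g))
    go (has2P₁+P₄ g)  = inj₂ (inj₂ (inj₁ (↪→⊆ g)))
    go (has3P₂ g)     = inj₂ (inj₂ (inj₂ (↪→⊆ g)))

  G4-rule : copies 4 (P 1) ↪ F → G4-target B → Out F B
  G4-rule f g = listed (⟪G4⟫ (↪→⊆ (emb! {H = K 4} ⨾ co-↪ f) , go g))
    where
    go : G4-target B → _
    go (hasK₁₄⁺⁺ g)  = inj₁ (↪→⊆ g)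
    go (hasP₁+2P₂ g) = inj₂ (inj₁ (↪→⊆ g))
    go (hasP₁+P₄ g)  = inj₂ (inj₂ (↪→⊆ g))

  G5-rule : copies 5 (P 1) ↪ F → Star1⁺⁺ 3 ↪ B → Out F B
  G5-rule f g = listed (⟪G5⟫ (↪→⊆ (emb! {H = K 5} ⨾ co-↪ f) , ↪→⊆ g))

  G6-rule : copies 2 (P 2) ↪ F → G6-target B → Out F B
  G6-rule f g = listed (⟪G6⟫ (↪→⊆ (emb! {H = C 4} ⨾ co-↪ f) , go g))
    where
    go : G6-target B → _
    go (hasK₁₃ g)   = inj₁ (↪→⊆ g)
    go (has3P₁+P₂ g) = inj₂ (inj₁ (↪→⊆ g))
    go (has2P₂ g)    = inj₂ (inj₂ (↪→⊆ g))

  G7-rule : copies 2 (P 1) ⊕ P 2 ↪ F → G7-target B → Out F B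
  G7-rule f g = listed (⟪G7⟫ (↪→⊆ (co-↪ f) , go g))
    where
    go : G7-target B → _
    go (hasK₁₃ g)   = inj₁ (↪→⊆ g)
    go (hasP₂+P₄ g) = inj₂ (inj₁ (↪→⊆ g))
    go (has2P₃ g)   = inj₂ (inj₂ (inj₁ (↪→⊆ g)))
    go (hasP₆ g)    = inj₂ (inj₂ (inj₂ (↪→⊆ g)))

  G8-rule : P 1 ⊕ P 4 ↪ F → P 1 ⊕ copies 2 (P 2) ↪ B → Out F B
  G8-rule f g = listed (⟪G8⟫ (↪→⊆ (co-↪ f) , ↪→⊆ g))

P1-ruleˡ : ∀ {F B} → F ↪ P 4 → Out F B
P1-ruleˡ f = out-sym (P1-rule f)

-- `co (P 1 ⊕ P 3)` is the paw by definition, so operation (b) reduces this forest to 3P₁.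
paw-out : ∀ {B} → Out (copies 3 (P 1)) B → Out (P 1 ⊕ P 3) B
paw-out {B} (out s) = out (settled-class
  (paw→k3 (~→≅ (~-refl {paw})) ◅ isoStep {K 3} {B} {co (copies 3 (P 1))} (emb! ⇄ emb!) (~-refl {B})) s)

six : ∀ b {F B} → F ~ co (left b) → B ~ right b → Out F B
six b f g = out (inj₂ (b , straight (~-trans (co-~ f) (co-co (left b))) g))

-- Pairs with a high shape

copies-mono : ∀ {s t} → s ≤ t → copies s (P 1) ↪ copies t (P 1)
copies-mono {t = t} z≤n = K0-↪ (copies t (P 1))
copies-mono (s≤s p)     = ⊕-monoʳ (P 1) (copies-mono p)

K₁₃↪star : ∀ s → Star1 3 ↪ ⟦ star (2 + s) ⟧
K₁₃↪star s = star-mono (NP.m≤m+n 3 s)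

K₁₃↪star⁺⁺ : ∀ s → Star1 3 ↪ ⟦ star⁺⁺ s ⟧
K₁₃↪star⁺⁺ s = emb! ⨾ star⁺⁺-mono s

K₁₃↪star⁺ : ∀ s → Star1 3 ↪ ⟦ star⁺ (suc s) ⟧
K₁₃↪star⁺ s = emb! {G = spider (2 ∷ 1 ∷ 1 ∷ [])} ⨾
  spider-mono (2 ∷ 1 ∷ 1 ∷ []) (2 ∷ replicate (2 + s) 1) (NP.≤-refl ∷ NP.≤-refl ∷ NP.≤-refl ∷ [])

2P₂↪ : ∀ h → copies 2 (P 2) ↪ high h
2P₂↪ (star⁺⁺ s)     = emb! ⨾ star⁺⁺-mono s
2P₂↪ (P₁+star⁺⁺ s)  = emb! ⨾ star⁺⁺-mono s ⨾ ⊕-inr (P 1) ⟦ star⁺⁺ s ⟧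
2P₂↪ (twoStars s r) = emb! {G = P 2 ⊕ P 2} ⨾ ⊕-mono (P₂↪ (star s)) (P₂↪ (star r))
2P₂↪ (P₁+P₂+star s) = emb! {G = P 1 ⊕ P 2 ⊕ P 2} ⨾ ⊕-monoʳ (P 1 ⊕ P 2) (P₂↪ (star s))
2P₂↪ P₂+P₄ = emb!
2P₂↪ P₅    = emb!
2P₂↪ P₁+P₅ = emb!
2P₂↪ P₆    = emb!
2P₂↪ P₇    = emb!
2P₂↪ S₁₂₂  = emb!
2P₂↪ S₁₂₃  = emb!

highHigh : ∀ h k → Out (high h) (high k)
highHigh h k = G6-rule (2P₂↪ h) (has2P₂ (2P₂↪ k))

twoStars↪ : ∀ {s r t} → s ≤ t → r ≤ t → ⟦ star s ⟧ ⊕ ⟦ star r ⟧ ↪ copies 2 (Star1 (suc t))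
twoStars↪ {t = t} p q = ⊕-mono (star-mono (s≤s p)) (star-mono (s≤s q) ⨾ ⊕-inl (Star1 (suc t)) K0)

triangle-high : ∀ h → Out (copies 3 (P 1)) (high h)
triangle-high (star⁺⁺ s)     = P5-rule emb! (inK₁ₜ⁺⁺+P₁ (2 + s) (⊕-inl ⟦ star⁺⁺ s ⟧ (P 1)))
triangle-high (P₁+star⁺⁺ s)  = P5-rule emb! (inK₁ₜ⁺⁺+P₁ (2 + s) (⊕-swap (P 1) ⟦ star⁺⁺ s ⟧))
triangle-high (twoStars s r) = P4-rule (2 + (s + r)) (copies-mono (NP.m≤m+n 3 (s + r)))
  (in2K₁ₜ (twoStars↪ (NP.≤-trans (NP.m≤m+n s r) (NP.m≤n+m (s + r) 2))
    (NP.≤-trans (NP.m≤n+m r s) (NP.m≤n+m (s + r) 2))))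
-- Deleting from K₁ₜ⁺⁺ the neighbour of the centre on the long leg leaves a star and a P₂; here t =
-- 2 + s.
triangle-high (P₁+P₂+star s) = P5-rule emb! (inK₁ₜ⁺⁺+P₁ (1 + s)
  (⊕-assocʳ (P 1) (P 2) ⟦ star s ⟧ ⨾ ⊕-swap (P 1) (P 2 ⊕ ⟦ star s ⟧) ⨾
    ⊕-monoˡ (P 1) (⊕-swap (P 2) ⟦ star s ⟧ ⨾ cutLeg 2 (replicate (1 + s) 1))))
triangle-high P₂+P₄ = P5-rule emb! (inP₂+P₄ emb!)
triangle-high P₅    = P5-rule emb! (inP₆ emb!)
triangle-high P₁+P₅ = P5-rule emb! (inK₁ₜ⁺⁺+P₁ 1 emb!)
triangle-high P₆    = P5-rule emb! (inP₆ emb!)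
triangle-high P₇    = six k3-p7 (emb! ⇄ emb!) ~-refl
triangle-high S₁₂₂  = P5-rule emb! (inS₁₂₂ emb!)
triangle-high S₁₂₃  = six k3-s123 (emb! ⇄ emb!) ~-refl

K₄-high : ∀ b h → Out (copies (4 + b) (P 1)) (high h)
K₄-high b h = go b h
  where
  4P₁↪ : ∀ b → copies 4 (P 1) ↪ copies (4 + b) (P 1)
  4P₁↪ b = copies-mono (NP.m≤m+n 4 b)
  go : ∀ b h → Out (copies (4 + b) (P 1)) (high h)
  -- K₁₃⁺⁺ is S₁₁₃: against K₄ itself it is one of the six pairs, from K₅ on (G5) applies, and with
  -- one more leaf (G4).
  go zero    (star⁺⁺ zero) = six k4-s113 (emb! ⇄ emb!) (emb! ⇄ emb!)
  go (suc b) (star⁺⁺ zero) = G5-rule (copies-mono (NP.m≤m+n 5 b)) emb!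
  go b (star⁺⁺ (suc s)) = G4-rule (4P₁↪ b) (hasK₁₄⁺⁺
    (spider-mono (3 ∷ replicate 3 1) (3 ∷ replicate (3 + s) 1)
      (NP.≤-refl ∷ NP.≤-refl ∷ NP.≤-refl ∷ NP.≤-refl ∷ [])))
  go b (P₁+star⁺⁺ s)  = G4-rule (4P₁↪ b) (hasP₁+P₄ (⊕-monoʳ (P 1) (P₄↪ (star⁺⁺ s))))
  go b (twoStars s r) = P4-rule (3 + (b + (s + r))) (copies-mono (NP.+-monoʳ-≤ 4 (NP.m≤m+n b (s + r))))
    (in2K₁ₜ (twoStars↪ (NP.≤-trans (NP.m≤m+n s r) (NP.≤-trans (NP.m≤n+m (s + r) b) (NP.m≤n+m (b + (s + r)) 3)))
      (NP.≤-trans (NP.m≤n+m r s) (NP.≤-trans (NP.m≤n+m (s + r) b) (NP.m≤n+m (b + (s + r)) 3)))))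
  go b (P₁+P₂+star s) = G4-rule (4P₁↪ b)
    (hasP₁+2P₂ (emb! {G = P 1 ⊕ P 2 ⊕ P 2} ⨾ ⊕-monoʳ (P 1 ⊕ P 2) (P₂↪ (star s))))
  go b P₂+P₄ = G4-rule (4P₁↪ b) (hasP₁+P₄ emb!)
  go b P₅    = P4-rule (3 + b) ↪-refl (inP₅ emb!)
  go b P₁+P₅ = G4-rule (4P₁↪ b) (hasP₁+P₄ emb!)
  go b P₆    = G4-rule (4P₁↪ b) (hasP₁+P₄ emb!)
  go b P₇    = G4-rule (4P₁↪ b) (hasP₁+P₄ emb!)
  go b S₁₂₂  = G4-rule (4P₁↪ b) (hasP₁+2P₂ emb!)
  go b S₁₂₃  = G4-rule (4P₁↪ b) (hasP₁+2P₂ emb!)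

-- The high shapes that (G7) leaves open against a graph containing 2P₁+P₂.
data Rest : Set where
  2P₂ P₂+P₃ P₃+P₂ P₁+2P₂ P₁+P₂+P₃ P₅ P₁+P₅ : Rest

rest : Rest → High
rest 2P₂      = twoStars 0 0
rest P₂+P₃    = twoStars 0 1
rest P₃+P₂    = twoStars 1 0
rest P₁+2P₂   = P₁+P₂+star 0
rest P₁+P₂+P₃ = P₁+P₂+star 1
rest P₅       = P₅
rest P₁+P₅    = P₁+P₅

-- (G7) disposes of K₁₃, P₂+P₄, 2P₃ and P₆. The same reduction serves 2P₁+P₂, 2P₁+P₃ and P₁+P₄,
-- which differ only in how they treat the remaining shapes. `twoStars` is ordered, so P₂+P₃ remains
-- twice.
diamond-high : ∀ {D} → copies 2 (P 1) ⊕ P 2 ↪ D → (∀ r → Out D (high (rest r))) → ∀ h → Out D (high h)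
diamond-high d f (star⁺⁺ s)    = G7-rule d (hasK₁₃ (K₁₃↪star⁺⁺ s))
diamond-high d f (P₁+star⁺⁺ s) = G7-rule d (hasK₁₃ (K₁₃↪star⁺⁺ s ⨾ ⊕-inr (P 1) ⟦ star⁺⁺ s ⟧))
diamond-high d f (twoStars 0 0) = f 2P₂
diamond-high d f (twoStars 0 1) = f P₂+P₃
diamond-high d f (twoStars 1 0) = f P₃+P₂
diamond-high d f (twoStars 1 1) = G7-rule d (has2P₃ emb!)
diamond-high d f (twoStars (suc (suc s)) r) =
  G7-rule d (hasK₁₃ (K₁₃↪star s ⨾ ⊕-inl ⟦ star (2 + s) ⟧ ⟦ star r ⟧))
diamond-high d f (twoStars s (suc (suc r))) =
  G7-rule d (hasK₁₃ (K₁₃↪star r ⨾ ⊕-inr ⟦ star s ⟧ ⟦ star (2 + r) ⟧))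
diamond-high d f (P₁+P₂+star 0) = f P₁+2P₂
diamond-high d f (P₁+P₂+star 1) = f P₁+P₂+P₃
diamond-high d f (P₁+P₂+star (suc (suc s))) =
  G7-rule d (hasK₁₃ (K₁₃↪star s ⨾ ⊕-inr (P 1 ⊕ P 2) ⟦ star (2 + s) ⟧))
diamond-high d f P₂+P₄ = G7-rule d (hasP₂+P₄ emb!)
diamond-high d f P₅    = f P₅
diamond-high d f P₁+P₅ = f P₁+P₅
diamond-high d f P₆    = G7-rule d (hasP₆ emb!)
diamond-high d f P₇    = G7-rule d (hasP₆ emb!)
diamond-high d f S₁₂₂  = G7-rule d (hasK₁₃ emb!)
diamond-high d f S₁₂₃  = G7-rule d (hasK₁₃ emb!)

2P₁+P₂-rest : ∀ r → Out (low (isolated+star 2 0)) (high (rest r))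
2P₁+P₂-rest 2P₂      = P8-rule emb! (inj₁ emb!)
2P₁+P₂-rest P₂+P₃    = P8-rule emb! (inj₁ emb!)
2P₁+P₂-rest P₃+P₂    = P8-rule emb! (inj₁ emb!)
2P₁+P₂-rest P₁+2P₂   = P6-rule emb! emb!
2P₁+P₂-rest P₁+P₂+P₃ = six diamond-p123 (emb! ⇄ emb!) (emb! ⇄ emb!)
2P₁+P₂-rest P₅       = P8-rule emb! (inj₂ emb!)
2P₁+P₂-rest P₁+P₅    = six diamond-p15 (emb! ⇄ emb!) ~-refl

2P₁+P₃-rest : ∀ r → Out (low (isolated+star 2 1)) (high (rest r))
2P₁+P₃-rest 2P₂      = P8-rule emb! (inj₁ emb!)
2P₁+P₃-rest P₂+P₃    = P8-rule emb! (inj₁ emb!)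
2P₁+P₃-rest P₃+P₂    = P8-rule emb! (inj₁ emb!)
2P₁+P₃-rest P₁+2P₂   = G4-rule emb! (hasP₁+2P₂ emb!)
2P₁+P₃-rest P₁+P₂+P₃ = G4-rule emb! (hasP₁+2P₂ emb!)
2P₁+P₃-rest P₅       = P8-rule emb! (inj₂ emb!)
2P₁+P₃-rest P₁+P₅    = G4-rule emb! (hasP₁+P₄ emb!)

P₁+P₄-rest : ∀ r → Out (low (P₁+star⁺ 0)) (high (rest r))
P₁+P₄-rest 2P₂      = P7-rule emb! (inj₂ emb!)
P₁+P₄-rest P₂+P₃    = six gem-p23 (emb! ⇄ emb!) (emb! ⇄ emb!)
P₁+P₄-rest P₃+P₂    = six gem-p23 (emb! ⇄ emb!) (emb! ⇄ emb!)
P₁+P₄-rest P₁+2P₂   = G8-rule emb! emb!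
P₁+P₄-rest P₁+P₂+P₃ = G8-rule emb! emb!
P₁+P₄-rest P₅       = P7-rule emb! (inj₂ emb!)
P₁+P₄-rest P₁+P₅    = G8-rule emb! emb!

-- A high shape contains 2P₂, so its complement contains C₄, and (G6) settles every low shape with
-- K₁₃ or 3P₁+P₂. Apart from edgeless graphs and subgraphs of P₄, this leaves P₁+P₃, 2P₁+P₂, 2P₁+P₃
-- and P₁+P₄.
lowHigh : ∀ l h → Out (low l) (high h)
lowHigh (isolated 0) h = P1-ruleˡ emb!
lowHigh (isolated 1) h = P1-ruleˡ emb!
lowHigh (isolated 2) h = P1-ruleˡ emb!
lowHigh (isolated 3) h = triangle-high h
lowHigh (isolated (suc (suc (suc (suc b))))) h = K₄-high b h
lowHigh (isolated+star a (suc (suc s))) h =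
  out-sym (G6-rule (2P₂↪ h) (hasK₁₃ (K₁₃↪star s ⨾ ⊕-inr (copies a (P 1)) ⟦ star (2 + s) ⟧)))
lowHigh (isolated+star 0 0) h = P1-ruleˡ emb!
lowHigh (isolated+star 1 0) h = P1-ruleˡ emb!
lowHigh (isolated+star 0 1) h = P1-ruleˡ emb!
lowHigh (isolated+star 1 1) h = out-resp {F′ = P 1 ⊕ P 3} (emb! ⇄ emb!) ~-refl (paw-out (triangle-high h))
lowHigh (isolated+star 2 0) h = diamond-high emb! 2P₁+P₂-rest h
lowHigh (isolated+star 2 1) h = diamond-high emb! 2P₁+P₃-rest h
lowHigh (isolated+star (suc (suc (suc a))) s) h =
  out-sym (G6-rule (2P₂↪ h) (has3P₁+P₂ (⊕-mono (copies-mono (NP.m≤m+n 3 a)) (P₂↪ (star s)))))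
lowHigh (star⁺ 0) h       = P1-ruleˡ emb!
lowHigh (star⁺ (suc s)) h = out-sym (G6-rule (2P₂↪ h) (hasK₁₃ (K₁₃↪star⁺ s)))
lowHigh (P₁+star⁺ 0) h    = diamond-high emb! P₁+P₄-rest h
lowHigh (P₁+star⁺ (suc s)) h =
  out-sym (G6-rule (2P₂↪ h) (hasK₁₃ (K₁₃↪star⁺ s ⨾ ⊕-inr (P 1) ⟦ star⁺ (suc s) ⟧)))

-- Pairs of two low shapes

copies↪star : ∀ {a t} → a ≤ t → copies a (P 1) ↪ Star1 t
copies↪star {a} p = mk↪ (_⊑_.funᵛ (leaves a)) (_⊑_.injᵛ (leaves a)) (_⊑_.presᵛ (leaves a)) ⨾ star-mono p

-- In 2K₁ₜ the `b` isolated vertices become leaves of one copy and the star goes into the other; t =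
-- 1 + a + b + s is large enough for all three sizes.
isolated-star : ∀ a b s → Out (copies a (P 1)) (low (isolated+star b s))
isolated-star a b s = P4-rule (a + (b + s)) (copies-mono (NP.≤-trans (NP.m≤m+n a (b + s)) (NP.n≤1+n _)))
  (in2K₁ₜ (⊕-mono
    (copies↪star (NP.≤-trans (NP.m≤m+n b s) (NP.≤-trans (NP.m≤n+m (b + s) a) (NP.n≤1+n _))))
    (star-mono (s≤s (NP.≤-trans (NP.m≤n+m s b) (NP.m≤n+m (b + s) a)))
      ⨾ ⊕-inl (Star1 (1 + (a + (b + s)))) K0)))

isolated-star⁺ : ∀ a s → Out (copies a (P 1)) ⟦ star⁺ s ⟧
isolated-star⁺ a s = P4-rule (1 + (a + s)) (copies-mono (NP.≤-trans (NP.m≤m+n a s) (NP.m≤n+m (a + s) 2)))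
  (inK₁ₜ⁺ (spider-mono (2 ∷ replicate (1 + s) 1) (2 ∷ replicate (1 + (a + s)) 1)
    (NP.≤-refl ∷ ones-≼ (s≤s (NP.m≤n+m s a)))))

isolated-P₁+star⁺ : ∀ a s → Out (copies a (P 1)) (low (P₁+star⁺ s))
isolated-P₁+star⁺ 0 s = P1-ruleˡ emb!
isolated-P₁+star⁺ 1 s = P1-ruleˡ emb!
isolated-P₁+star⁺ 2 s = P1-ruleˡ emb!
isolated-P₁+star⁺ 3 s = P5-rule emb! (inK₁ₜ⁺⁺+P₁ (1 + s) (⊕-swap (P 1) ⟦ star⁺ s ⟧ ⨾
  ⊕-monoˡ (P 1) (spider-mono (2 ∷ replicate (1 + s) 1) (3 ∷ replicate (1 + s) 1) (NP.n≤1+n 2 ∷ ≼-refl))))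
isolated-P₁+star⁺ (suc (suc (suc (suc a)))) s =
  G4-rule (copies-mono (NP.m≤m+n 4 a)) (hasP₁+P₄ (⊕-monoʳ (P 1) (P₄↪ (star⁺ s))))

isolated-low : ∀ a l → Out (copies a (P 1)) (low l)
isolated-low a (isolated b) = P2-rule (a + b)
  (copies↪star (NP.≤-trans (NP.m≤m+n a b) (NP.n≤1+n _)) ⨾ ⊕-inl (Star1 (1 + (a + b))) (P 1))
  (copies↪star (NP.≤-trans (NP.m≤n+m b a) (NP.n≤1+n _)) ⨾ ⊕-inl (Star1 (1 + (a + b))) (P 1))
isolated-low a (isolated+star b s) = isolated-star a b s
isolated-low a (star⁺ s)           = isolated-star⁺ a s
isolated-low a (P₁+star⁺ s)        = isolated-P₁+star⁺ a s

2P₁+P₂↪ : ∀ a s → copies 2 (P 1) ⊕ P 2 ↪ low (isolated+star (2 + a) s)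
2P₁+P₂↪ a s = ⊕-mono (copies-mono (NP.m≤m+n 2 a)) (P₂↪ (star s))

K₁₃↪ : ∀ a s → Star1 3 ↪ low (isolated+star a (2 + s))
K₁₃↪ a s = K₁₃↪star s ⨾ ⊕-inr (copies a (P 1)) ⟦ star (2 + s) ⟧

star-P₁+P₃ : ∀ a s {B} → B ~ P 1 ⊕ P 3 → Out (low (isolated+star a s)) B
star-P₁+P₃ a s e = out-sym (out-resp e ~-refl (paw-out (isolated-star 3 a s)))

short↪ : ∀ {s} → s ≤ 1 → ∀ {a t} → a ≤ t → low (isolated+star a s) ↪ copies t (P 1) ⊕ P 3
short↪ {s} p q = ⊕-mono (copies-mono q) (star-mono (s≤s p) ⨾ emb! {Star1 2})

few↪ : ∀ {a} → a ≤ 1 → ∀ {s t} → s ≤ t → low (isolated+star a s) ↪ Star1 (suc t) ⊕ P 1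
few↪ {a} p {s} {t} q = ⊕-mono (copies-mono p ⨾ emb! {copies 1 (P 1)} {P 1}) (star-mono (s≤s q)) ⨾ ⊕-swap (P 1) (Star1 (suc t))

bothShort : ∀ a b {s r} → s ≤ 1 → r ≤ 1 → Out (low (isolated+star (2 + a) s)) (low (isolated+star b r))
bothShort a b p q = P3-rule (1 + (a + b)) (short↪ p (NP.m≤m+n (2 + a) b))
  (short↪ q (NP.m≤n+m b (2 + a)))

-- The first forest contains 2P₁+P₂, so (G7) excludes a claw in the second, and likewise with the
-- roles exchanged. If neither star is a claw or larger, (P3) applies. Otherwise the second forest
-- has at most one isolated vertex beside P₂ or P₃: it lies in P₄ or is P₁+P₃, the complement of the
-- paw.
manyIsolated : ∀ a s b r → Out (low (isolated+star (2 + a) s)) (low (isolated+star b r))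
manyIsolated a s b (suc (suc r))       = G7-rule (2P₁+P₂↪ a s) (hasK₁₃ (K₁₃↪ b r))
manyIsolated a (suc (suc s)) (suc (suc b)) r =
  out-sym (G7-rule (2P₁+P₂↪ b r) (hasK₁₃ (K₁₃↪ (2 + a) s)))
manyIsolated a s 0 0 = P1-rule emb!
manyIsolated a s 0 1 = P1-rule emb!
manyIsolated a s 1 0 = P1-rule emb!
manyIsolated a s 1 1 = star-P₁+P₃ (2 + a) s (emb! ⇄ emb!)
manyIsolated a 0 b 0 = bothShort a b z≤n z≤n
manyIsolated a 0 b 1 = bothShort a b z≤n NP.≤-refl
manyIsolated a 1 b 0 = bothShort a b NP.≤-refl z≤n
manyIsolated a 1 b 1 = bothShort a b NP.≤-refl NP.≤-refl

fewIsolated : ∀ {a b} s r → a ≤ 1 → b ≤ 1 → Out (low (isolated+star a s)) (low (isolated+star b r))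
fewIsolated s r p q = P2-rule (s + r) (few↪ p (NP.m≤m+n s r)) (few↪ q (NP.m≤n+m r s))

star-star : ∀ a s b r → Out (low (isolated+star a s)) (low (isolated+star b r))
star-star (suc (suc a)) s b r = manyIsolated a s b r
star-star a s (suc (suc b)) r = out-sym (manyIsolated b r a s)
star-star 0 s 0 r = fewIsolated s r z≤n z≤n
star-star 0 s 1 r = fewIsolated s r z≤n NP.≤-refl
star-star 1 s 0 r = fewIsolated s r NP.≤-refl z≤n
star-star 1 s 1 r = fewIsolated s r NP.≤-refl NP.≤-refl

-- A forest with both 2P₁+P₂ and K₁₃ can stand on either side of (G7), which leaves subgraphs of P₄
-- and P₁+P₃. The hypothesis about 3P₁ settles the latter through `paw-out`.
star-thick : ∀ {B} → copies 2 (P 1) ⊕ P 2 ↪ B → Star1 3 ↪ B → Out (copies 3 (P 1)) B →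
  ∀ a s → Out (low (isolated+star a s)) B
star-thick d k t (suc (suc a)) s = G7-rule (2P₁+P₂↪ a s) (hasK₁₃ k)
star-thick d k t a (suc (suc s)) = out-sym (G7-rule d (hasK₁₃ (K₁₃↪ a s)))
star-thick d k t 0 0 = P1-ruleˡ emb!
star-thick d k t 0 1 = P1-ruleˡ emb!
star-thick d k t 1 0 = P1-ruleˡ emb!
star-thick d k t 1 1 = out-resp {F′ = P 1 ⊕ P 3} (emb! ⇄ emb!) ~-refl (paw-out t)

2P₁+P₂↪star⁺ : ∀ s → copies 2 (P 1) ⊕ P 2 ↪ ⟦ star⁺ (suc s) ⟧
2P₁+P₂↪star⁺ s = emb! {G = spider (2 ∷ 1 ∷ 1 ∷ [])} ⨾
  spider-mono (2 ∷ 1 ∷ 1 ∷ []) (2 ∷ replicate (2 + s) 1) (NP.≤-refl ∷ NP.≤-refl ∷ NP.≤-refl ∷ [])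

-- Claws fall to (G7) and forests with 4P₁ to (G4). What is left embeds in P₄ or in P₁+P₄, where
-- (P1) or (P7) applies.
star-P₁+P₄ : ∀ a s → Out (low (isolated+star a s)) (low (P₁+star⁺ 0))
star-P₁+P₄ a (suc (suc s)) = out-sym (G7-rule emb! (hasK₁₃ (K₁₃↪ a s)))
star-P₁+P₄ 0 0 = P1-ruleˡ emb!
star-P₁+P₄ 1 0 = P1-ruleˡ emb!
star-P₁+P₄ 2 0 = P7-rule emb! (inj₁ emb!)
star-P₁+P₄ 0 1 = P1-ruleˡ emb!
star-P₁+P₄ 1 1 = P7-rule emb! (inj₁ emb!)
star-P₁+P₄ (suc (suc (suc a))) 0 = G4-rule
  (emb! {G = copies 3 (P 1) ⊕ Star1 1} ⨾ ⊕-monoˡ (Star1 1) (copies-mono (NP.m≤m+n 3 a))) (hasP₁+P₄ emb!)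
star-P₁+P₄ (suc (suc a)) 1 = G4-rule
  (emb! {G = copies 2 (P 1) ⊕ Star1 2} ⨾ ⊕-monoˡ (Star1 2) (copies-mono (NP.m≤m+n 2 a))) (hasP₁+P₄ emb!)

K₁₃↪P₁+star⁺ : ∀ s → Star1 3 ↪ low (P₁+star⁺ (suc s))
K₁₃↪P₁+star⁺ s = K₁₃↪star⁺ s ⨾ ⊕-inr (P 1) ⟦ star⁺ (suc s) ⟧

2P₁+P₂↪P₁+star⁺ : ∀ s → copies 2 (P 1) ⊕ P 2 ↪ low (P₁+star⁺ s)
2P₁+P₂↪P₁+star⁺ s = emb! {G = P 1 ⊕ P 4} ⨾ ⊕-monoʳ (P 1) (P₄↪ (star⁺ s))

star-low : ∀ a s l → Out (low (isolated+star a s)) (low l)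
star-low a s (isolated b)        = out-sym (isolated-star b a s)
star-low a s (isolated+star b r) = star-star a s b r
star-low a s (star⁺ 0)           = P1-rule emb!
star-low a s (star⁺ (suc r))     =
  star-thick (2P₁+P₂↪star⁺ r) (K₁₃↪star⁺ r) (isolated-star⁺ 3 (suc r)) a s
star-low a s (P₁+star⁺ 0)        = star-P₁+P₄ a s
star-low a s (P₁+star⁺ (suc r))  =
  star-thick (2P₁+P₂↪P₁+star⁺ (suc r)) (K₁₃↪P₁+star⁺ r) (isolated-P₁+star⁺ 3 (suc r)) a s

lowLow : ∀ l m → Out (low l) (low m)
lowLow (isolated a) m = isolated-low a m
lowLow l (isolated a) = out-sym (isolated-low a l)
lowLow (isolated+star a s) m = star-low a s m
lowLow l (isolated+star a s) = out-sym (star-low a s l)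
lowLow (star⁺ 0) m = P1-ruleˡ emb!
lowLow l (star⁺ 0) = P1-rule emb!
lowLow (star⁺ (suc s)) (star⁺ (suc r))       = G7-rule (2P₁+P₂↪star⁺ s) (hasK₁₃ (K₁₃↪star⁺ r))
lowLow (star⁺ (suc s)) (P₁+star⁺ r)          =
  out-sym (G7-rule (2P₁+P₂↪P₁+star⁺ r) (hasK₁₃ (K₁₃↪star⁺ s)))
lowLow (P₁+star⁺ s) (star⁺ (suc r))          = G7-rule (2P₁+P₂↪P₁+star⁺ s) (hasK₁₃ (K₁₃↪star⁺ r))
lowLow (P₁+star⁺ s) (P₁+star⁺ (suc r))       = G7-rule (2P₁+P₂↪P₁+star⁺ s) (hasK₁₃ (K₁₃↪P₁+star⁺ r))
lowLow (P₁+star⁺ (suc s)) (P₁+star⁺ 0)       =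
  out-sym (G7-rule (2P₁+P₂↪P₁+star⁺ 0) (hasK₁₃ (K₁₃↪P₁+star⁺ s)))
lowLow (P₁+star⁺ 0) (P₁+star⁺ 0)             = P7-rule emb! (inj₁ emb!)

-- Obstructed forests

data Trichotomy (B : Graph) : Set where
  ⊆P₄  : B ↪ P 4 → Trichotomy B
  3P₁⊆ : copies 3 (P 1) ↪ B → Trichotomy B
  2P₂⊆ : copies 2 (P 2) ↪ B → Trichotomy B

trichotomy-low : ∀ l → Trichotomy (low l)
trichotomy-low (isolated 0) = ⊆P₄ emb!
trichotomy-low (isolated 1) = ⊆P₄ emb!
trichotomy-low (isolated 2) = ⊆P₄ emb!
trichotomy-low (isolated (suc (suc (suc a)))) = 3P₁⊆ (copies-mono (NP.m≤m+n 3 a))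
trichotomy-low (isolated+star a (suc (suc s))) = 3P₁⊆ (emb! {G = Star1 3} ⨾ K₁₃↪ a s)
trichotomy-low (isolated+star 0 0) = ⊆P₄ emb!
trichotomy-low (isolated+star 1 0) = ⊆P₄ emb!
trichotomy-low (isolated+star 0 1) = ⊆P₄ emb!
trichotomy-low (isolated+star 1 1) = 3P₁⊆ emb!
trichotomy-low (isolated+star (suc (suc a)) s) = 3P₁⊆ (emb! {G = copies 2 (P 1) ⊕ P 2} ⨾ 2P₁+P₂↪ a s)
trichotomy-low (star⁺ 0)       = ⊆P₄ emb!
trichotomy-low (star⁺ (suc s)) = 3P₁⊆ (emb! {G = Star1 3} ⨾ K₁₃↪star⁺ s)
trichotomy-low (P₁+star⁺ s)    = 3P₁⊆ (emb! {G = P 1 ⊕ P 4} ⨾ ⊕-monoʳ (P 1) (P₄↪ (star⁺ s)))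

trichotomy : ∀ {B} → Classified B → Trichotomy B
trichotomy (obstructed (has2P₁+2P₂ e)) = 2P₂⊆ (emb! ⨾ e)
trichotomy (obstructed (hasP₁+2P₃ e))  = 2P₂⊆ (emb! ⨾ e)
trichotomy (obstructed (has2P₁+P₄ e))  = 3P₁⊆ (emb! ⨾ e)
trichotomy (obstructed (has3P₂ e))     = 2P₂⊆ (emb! ⨾ e)
trichotomy (isHigh h e) = 2P₂⊆ (2P₂↪ h ⨾ from e)
trichotomy (isLow l e) with trichotomy-low l
... | ⊆P₄ f  = ⊆P₄ (to e ⨾ f)
... | 3P₁⊆ f = 3P₁⊆ (f ⨾ from e)
... | 2P₂⊆ f = 2P₂⊆ (f ⨾ from e)

obstructed-out : ∀ {F B} → Trichotomy F → Obstructed B → Out F B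
obstructed-out (⊆P₄ f)  o = P1-ruleˡ f
obstructed-out (3P₁⊆ f) o = G3-rule f o
obstructed-out (2P₂⊆ f) (has2P₁+2P₂ e) = G6-rule f (has2P₂ (emb! ⨾ e))
obstructed-out (2P₂⊆ f) (hasP₁+2P₃ e)  = G6-rule f (has2P₂ (emb! ⨾ e))
-- This is the one obstruction without 2P₂; deleting an inner vertex of its P₄ leaves 3P₁+P₂.
obstructed-out (2P₂⊆ f) (has2P₁+P₄ e)  = G6-rule f (has3P₁+P₂ (emb! ⨾ e))
obstructed-out (2P₂⊆ f) (has3P₂ e)     = G6-rule f (has2P₂ (emb! ⨾ e))

classified-out : ∀ {F B} → Classified F → Classified B → Out F B
classified-out c (obstructed o) = obstructed-out (trichotomy c) o
classified-out (obstructed o) c = out-sym (obstructed-out (trichotomy c) o)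
classified-out (isLow l e)  (isLow m f)  = out-resp e f (lowLow l m)
classified-out (isLow l e)  (isHigh h f) = out-resp e f (lowHigh l h)
classified-out (isHigh h e) (isLow l f)  = out-sym (out-resp f e (lowHigh l h))
classified-out (isHigh h e) (isHigh k f) = out-resp e f (highHigh h k)

-- Path star forests have no cycles

-- Every vertex has at most one neighbour of smaller index, so the last vertex
-- of a cycle would be a contradiction.
record Arborescent (G : Graph) : Set where
  field
    upwards : ∀ {i j} → rel G i j ≡ true → i F.< j
    unique  : ∀ {i j k} → rel G i k ≡ true → rel G j k ≡ true → i ≡ j
open Arborescent

↑ˡ-mono-< : ∀ {m} n {i j : Fin m} → i F.< j → (i ↑ˡ n) F.< (j ↑ˡ n)
↑ˡ-mono-< n {i} {j} p = subst₂ _<_ (sym (FP.toℕ-↑ˡ i n)) (sym (FP.toℕ-↑ˡ j n)) p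

↑ʳ-mono-< : ∀ m {n} {i j : Fin n} → i F.< j → (m ↑ʳ i) F.< (m ↑ʳ j)
↑ʳ-mono-< m {n} {i} {j} p = subst₂ _<_ (sym (FP.toℕ-↑ʳ m i)) (sym (FP.toℕ-↑ʳ m j)) (NP.+-monoʳ-< m p)

↑ˡ<↑ʳ : ∀ {m n} (i : Fin m) (j : Fin n) → (i ↑ˡ n) F.< (m ↑ʳ j)
↑ˡ<↑ʳ {m} {n} i j = subst₂ _<_ (sym (FP.toℕ-↑ˡ i n)) (sym (FP.toℕ-↑ʳ m j))
  (NP.<-≤-trans (FP.toℕ<n i) (NP.m≤m+n m (toℕ j)))

≡ᵇ⇒≡ : ∀ {m n} → (m ≡ᵇ n) ≡ true → m ≡ n
≡ᵇ⇒≡ {m} {n} e = NP.≡ᵇ⇒≡ m n (Equivalence.from T-≡ e)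

≢-zero : ∀ {m n} → (m ≡ᵇ 0) ≡ true → (m ≡ᵇ suc n) ≡ true → ⊥
≢-zero {zero} _ ()

arborescent-⊕ : ∀ {G H} → Arborescent G → Arborescent H → Arborescent (G ⊕ H)
arborescent-⊕ {G} {H} g h = record { upwards = λ {i} {j} → up i j ; unique = λ {i} {j} {k} → un i j k }
  where
  m = size G
  n = size H
  up : ∀ i j → rel (G ⊕ H) i j ≡ true → i F.< j
  up i j e with splitAt m i in p | splitAt m j in q
  ... | inj₁ a | inj₁ b = subst₂ F._<_ (FP.splitAt⁻¹-↑ˡ p) (FP.splitAt⁻¹-↑ˡ q) (↑ˡ-mono-< n (upwards g e))
  ... | inj₂ a | inj₂ b = subst₂ F._<_ (FP.splitAt⁻¹-↑ʳ p) (FP.splitAt⁻¹-↑ʳ q) (↑ʳ-mono-< m (upwards h e))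
  un : ∀ i j k → rel (G ⊕ H) i k ≡ true → rel (G ⊕ H) j k ≡ true → i ≡ j
  un i j k e e′ with splitAt m i in p | splitAt m j in q | splitAt m k
  ... | inj₁ a | inj₁ b | inj₁ c = trans (sym (FP.splitAt⁻¹-↑ˡ p))
    (trans (cong (_↑ˡ n) (unique g e e′)) (FP.splitAt⁻¹-↑ˡ q))
  ... | inj₂ a | inj₂ b | inj₂ c = trans (sym (FP.splitAt⁻¹-↑ʳ p))
    (trans (cong (m ↑ʳ_) (unique h e e′)) (FP.splitAt⁻¹-↑ʳ q))

arborescent-spider : ∀ ls → Arborescent (spider ls)
arborescent-spider [] = record { upwards = λ () ; unique = λ () }
arborescent-spider (l ∷ ls) = record { upwards = λ {i} {j} → up i j ; unique = λ {i} {j} {k} → un i j k }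
  where
  m = spiderSize ls
  g = arborescent-spider ls
  up : ∀ i j → spiderRel (l ∷ ls) i j ≡ true → i F.< j
  up i j e with splitAt m i in p | splitAt m j in q
  ... | inj₁ a | inj₁ b = subst₂ F._<_ (FP.splitAt⁻¹-↑ˡ p) (FP.splitAt⁻¹-↑ˡ q) (↑ˡ-mono-< l (upwards g e))
  ... | inj₁ a | inj₂ b = subst₂ F._<_ (FP.splitAt⁻¹-↑ˡ p) (FP.splitAt⁻¹-↑ʳ q) (↑ˡ<↑ʳ a b)
  ... | inj₂ a | inj₂ b = subst₂ F._<_ (FP.splitAt⁻¹-↑ʳ p) (FP.splitAt⁻¹-↑ʳ q)
    (↑ʳ-mono-< m (NP.≤-reflexive (sym (≡ᵇ⇒≡ e))))
  un : ∀ i j k → spiderRel (l ∷ ls) i k ≡ true → spiderRel (l ∷ ls) j k ≡ true → i ≡ j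
  un i j k e e′ with splitAt m i in p | splitAt m j in q | splitAt m k
  ... | inj₁ a | inj₁ b | inj₁ c = trans (sym (FP.splitAt⁻¹-↑ˡ p))
    (trans (cong (_↑ˡ l) (unique g e e′)) (FP.splitAt⁻¹-↑ˡ q))
  ... | inj₁ a | inj₁ b | inj₂ c = trans (sym (FP.splitAt⁻¹-↑ˡ p))
    (trans (cong (_↑ˡ l) (FP.toℕ-injective (trans (≡ᵇ⇒≡ {toℕ a} (proj₁ (∧-split _ _ e)))
      (sym (≡ᵇ⇒≡ {toℕ b} (proj₁ (∧-split _ _ e′))))))) (FP.splitAt⁻¹-↑ˡ q))
  -- The first vertex of a leg has the centre as its parent, every later one its predecessor; `c`
  -- cannot be both.
  ... | inj₁ a | inj₂ b | inj₂ c = ⊥-elim (≢-zero {toℕ c} (proj₂ (∧-split _ _ e)) e′)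
  ... | inj₂ a | inj₁ b | inj₂ c = ⊥-elim (≢-zero {toℕ c} (proj₂ (∧-split _ _ e′)) e)
  ... | inj₂ a | inj₂ b | inj₂ c = trans (sym (FP.splitAt⁻¹-↑ʳ p))
    (trans (cong (m ↑ʳ_) (FP.toℕ-injective (NP.suc-injective (trans (sym (≡ᵇ⇒≡ {toℕ c} e)) (≡ᵇ⇒≡ {toℕ c} e′)))))
      (FP.splitAt⁻¹-↑ʳ q))

arborescent-spiders : ∀ lss → Arborescent (spiders lss)
arborescent-spiders []         = record { upwards = λ () ; unique = λ () }
arborescent-spiders (ls ∷ lss) = arborescent-⊕ (arborescent-spider ls) (arborescent-spiders lss)

argmax : ∀ {n} (g : Fin (suc n) → ℕ) → Σ (Fin (suc n)) λ i → ∀ j → g j ≤ g i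
argmax {zero}  g = zero , λ { zero → NP.≤-refl }
argmax {suc n} g with argmax (g ∘ suc)
... | i , h with NP.≤-total (g (suc i)) (g zero)
...   | inj₁ p = zero , λ { zero → NP.≤-refl ; (suc j) → NP.≤-trans (h j) p }
...   | inj₂ p = suc i , λ { zero → p ; (suc j) → h j }

parent : ∀ {G} → Arborescent G → ∀ {i j} → toℕ i ≤ toℕ j → Adj G i j ≡ true → rel G i j ≡ true
parent {G} g {i} {j} i≤j e with rel G i j | rel G j i in q
... | true  | _     = refl
... | false | true  = ⊥-elim (NP.<⇒≱ (upwards g q) i≤j)
... | false | false = case trans (sym e) (∧-zeroʳ (not ⌊ i F.≟ j ⌋)) of λ ()

-- Two distinct neighbours at every vertex are all that is used of a cycle. At the vertex whose
-- image has the largest index, both would map to the unique parent.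
no-cycle : ∀ H {G n} → size H ≡ suc n → Arborescent G →
  (∀ v → Σ (Fin (size H) × Fin (size H)) λ (u , w) → u ≢ w × Adj H u v ≡ true × Adj H w v ≡ true) →
  ¬ H ↪ G
no-cycle H {G} refl g nb (mk↪ f inj-f a) with argmax (toℕ ∘ f)
... | v , max with nb v
...   | (u , w) , u≢w , p , q = u≢w (inj-f (unique g
  (parent g (max u) (trans (sym (a u v)) p)) (parent g (max w) (trans (sym (a w v)) q))))

no-K₃ : ∀ {G} → Arborescent G → ¬ K 3 ↪ G
no-K₃ g = no-cycle (K 3) refl g λ
  { zero             → (suc zero , suc (suc zero)) , (λ ()) , refl , refl
  ; (suc zero)       → (zero , suc (suc zero)) , (λ ()) , refl , refl
  ; (suc (suc zero)) → (zero , suc zero) , (λ ()) , refl , refl }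

no-C₄ : ∀ {G} → Arborescent G → ¬ C 4 ↪ G
no-C₄ g = no-cycle (C 4) refl g λ
  { zero                   → (suc zero , suc (suc (suc zero))) , (λ ()) , refl , refl
  ; (suc zero)             → (zero , suc (suc zero)) , (λ ()) , refl , refl
  ; (suc (suc zero))       → (suc zero , suc (suc (suc zero))) , (λ ()) , refl , refl
  ; (suc (suc (suc zero))) → (zero , suc (suc zero)) , (λ ()) , refl , refl }

-- Every class outside the list is one of the six

forest : ∀ {G} → PathStarForest G → Classified G
forest {G} (lss , e) = classified-resp (≅→~ {G} {spiders lss} e) (classify lss)

forest-coforest : ∀ A → PathStarForest A → PathStarForest (co A) → A ↪ P 4
forest-coforest A p (lss , e) with trichotomy (forest {A} p)
... | ⊆P₄ f  = f
... | 3P₁⊆ f = ⊥-elim (no-K₃ (arborescent-spiders lss)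
  (emb! {G = co (copies 3 (P 1))} ⨾ co-↪ f ⨾ to (≅→~ {co A} {spiders lss} e)))
... | 2P₂⊆ f = ⊥-elim (no-C₄ (arborescent-spiders lss)
  (emb! {G = co (copies 2 (P 2))} ⨾ co-↪ f ⨾ to (≅→~ {co A} {spiders lss} e)))

-- The double negation permits a case distinction on `PathStarForest`. It suffices because a listed
-- equivalent is refuted by hypothesis and `InSix` is decidable.
¬¬settled : ∀ A B → ¬ ¬ Settled (A , B)
-- The failure of (G1) makes `A` or `B` a forest, the failure of (G2) makes `co A` or `co B` one.
-- The four combinations either embed a graph in P₄ or give a pair of forests to classify.
¬¬settled A B k = atFirst (λ a → atSecond (first-co a) (first-coB a)) (λ b → atSecond (coA-B b) (both-B b))
  where
  viaListed : Listed A B → ⊥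
  viaListed l = k (inj₁ (A , B , l , ε))
  atFirst : (PathStarForest A → ⊥) → (PathStarForest B → ⊥) → ⊥
  atFirst ¬a ¬b = viaListed (⟪G1⟫ (¬a , ¬b))
  atSecond : (PathStarForest (co A) → ⊥) → (PathStarForest (co B) → ⊥) → ⊥
  atSecond ¬a ¬b = viaListed (⟪G2⟫ (¬a , ¬b))
  first-co : PathStarForest A → PathStarForest (co A) → ⊥
  first-co a a′ = viaListed (⟪P1⟫ (inj₁ (↪→⊆ (forest-coforest A a a′))))
  both-B : PathStarForest B → PathStarForest (co B) → ⊥
  both-B b b′ = viaListed (⟪P1⟫ (inj₂ (↪→⊆ (forest-coforest B b b′))))
  coA-B : PathStarForest B → PathStarForest (co A) → ⊥
  coA-B b a′ = k (settled-class (isoStep (~-sym (co-co A)) (~-refl {B}))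
    (Out.settled (classified-out (forest {co A} a′) (forest {B} b))))
  first-coB : PathStarForest A → PathStarForest (co B) → ⊥
  first-coB a b′ = k (settled-class (swap ◅ isoStep (~-sym (co-co B)) (~-refl {A}))
    (Out.settled (classified-out (forest {co B} b′) (forest {A} a))))

-- Infinite families collapsed to finite graphs

infixr 9 _⨾⇉_
_⨾⇉_ : ∀ {A B C} → A ↪ B → B ⇉ C → A ⇉ C
f ⨾⇉ g = mk⇉ (hom g ∘ fun f) λ i j → trans (adj f i j) (full g (fun f i) (fun f j))

⇉-⊕ : ∀ {A A′ B B′} → A ⇉ A′ → B ⇉ B′ → A ⊕ B ⇉ A′ ⊕ B′
⇉-⊕ {A} {A′} {B} {B′} f g = mk⇉ (unite ∘ both ∘ split) λ i j → trans (_⊑_.presᵛ (splitᵛ A B) i j)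
  (trans (mid (split i) (split j)) (_⊑_.presᵛ (joinᵛ A′ B′) (both (split i)) (both (split j))))
  where
  split = splitAt (size A)
  unite = join (size A′) (size B′)
  both = Sum.map (hom f) (hom g)
  mid : ∀ x y → RootedGraph.adjᵛ (unrooted A ⊎ᵛ unrooted B) x y ≡
    RootedGraph.adjᵛ (unrooted A′ ⊎ᵛ unrooted B′) (both x) (both y)
  mid (inj₁ x) (inj₁ y) = full f x y
  mid (inj₁ _) (inj₂ _) = refl
  mid (inj₂ _) (inj₁ _) = refl
  mid (inj₂ x) (inj₂ y) = full g x y

copies⇉ : ∀ t → copies t (P 1) ⇉ P 1
copies⇉ t = mk⇉ (λ _ → zero) (edgeless t)

co-K⇉ : ∀ t → co (K t) ⇉ P 1
co-K⇉ t = mk⇉ (λ _ → zero) λ i j → trans (Adj-co (K t) i j) (lem ⌊ i F.≟ j ⌋)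
  where
  lem : ∀ b → not b ∧ not (not b ∧ true) ≡ false
  lem false = refl
  lem true  = refl

-- A full homomorphism to Q for which q can serve as the image of further leaves.
record LeafReady (Q : Graph) (q : Fin (size Q)) (ls : List ℕ) : Set where
  field
    collapse : spider ls ⇉ Q
    leafable : ∀ i → Adj Q (hom collapse i) q ≡ (toℕ i ≡ᵇ 0)
open LeafReady

addLeaf : ∀ {Q q ls} → LeafReady Q q ls → LeafReady Q q (1 ∷ ls)
addLeaf {Q} {q} {ls} c = record
  { collapse = mk⇉ (h ∘ split) λ i j → trans (_⊑_.presᵛ (splitLeg 1 ls) i j) (mid (split i) (split j))
  ; leafable = λ i → trans (leaf (split i)) (sym (_⊑_.rootᵛ (splitLeg 1 ls) i))
  }
  where
  split = splitAt (spiderSize ls)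
  h : Fin (spiderSize ls) ⊎ Fin 1 → Fin (size Q)
  h = [ hom (collapse c) , (λ _ → q) ]′
  mid : ∀ x y → RootedGraph.adjᵛ (rooted (spider ls) ◁ 1) x y ≡ Adj Q (h x) (h y)
  mid (inj₁ x) (inj₁ y)    = full (collapse c) x y
  mid (inj₁ x) (inj₂ zero) = trans (∧-identityʳ _) (sym (leafable c x))
  mid (inj₂ zero) (inj₁ y) = trans (mid (inj₁ y) (inj₂ zero)) (Adj-sym Q (hom (collapse c) y) q)
  mid (inj₂ zero) (inj₂ zero) = sym (Adj-irrefl Q q)
  leaf : ∀ x → Adj Q (h x) q ≡ RootedGraph.root (rooted (spider ls) ◁ 1) x
  leaf (inj₁ x) = leafable c x
  leaf (inj₂ _) = Adj-irrefl Q q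

addLeaves : ∀ {Q q ls} n → LeafReady Q q ls → LeafReady Q q (replicate n 1 ++ ls)
addLeaves zero    c = c
addLeaves (suc n) c = addLeaf (addLeaves n c)

star⇉ : ∀ t → Star1 t ⇉ P 2
star⇉ t = ≲→↪ (↭→≲ (↭-reflexive (sym (++-identityʳ (replicate t 1))))) ⨾⇉ collapse (addLeaves t base)
  where
  base : LeafReady (P 2) (suc zero) []
  base = record { collapse = mk⇉ (λ _ → zero) λ { zero zero → refl } ; leafable = λ { zero → refl } }

-- Leaves at the centre are twins. They all go to the end `zero` of P₄, and the centre with its long
-- leg is shifted to the positions 1, 2, 3.
star⁺⇉ : ∀ t → Star1⁺ t ⇉ P 4
-- `addLeaves` puts its legs in front, so the long leg is moved to the end.
star⁺⇉ t = ≲→↪ (↭→≲ (∷↭∷ʳ 2 (replicate (t ∸ 1) 1))) ⨾⇉ collapse (addLeaves (t ∸ 1) base)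
  where
  base : LeafReady (P 4) zero (2 ∷ [])
  base = record
    { collapse = mk⇉ suc (from-yes (FP.all? λ i → FP.all? λ j → Adj (spider (2 ∷ [])) i j B.≟ Adj (P 4) (suc i) (suc j)))
    ; leafable = from-yes (FP.all? λ (i : Fin 3) → Adj (P 4) (suc i) zero B.≟ (toℕ i ≡ᵇ 0))
    }

star⁺⁺⇉ : ∀ t → Star1⁺⁺ t ⇉ P 5
star⁺⁺⇉ t = ≲→↪ (↭→≲ (∷↭∷ʳ 3 (replicate (t ∸ 1) 1))) ⨾⇉ collapse (addLeaves (t ∸ 1) base)
  where
  base : LeafReady (P 5) zero (3 ∷ [])
  base = record
    { collapse = mk⇉ suc (from-yes (FP.all? λ i → FP.all? λ j → Adj (spider (3 ∷ [])) i j B.≟ Adj (P 5) (suc i) (suc j)))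
    ; leafable = from-yes (FP.all? λ (i : Fin 4) → Adj (P 5) (suc i) zero B.≟ (toℕ i ≡ᵇ 0))
    }

⇉-refl : ∀ G → G ⇉ G
⇉-refl G = mk⇉ id λ _ _ → refl

star+P₁⇉ : ∀ t → Star1 t ⊕ P 1 ⇉ P 2 ⊕ P 1
star+P₁⇉ t = ⇉-⊕ (star⇉ t) (⇉-refl (P 1))

star⁺⁺+P₁⇉ : ∀ t → Star1⁺⁺ t ⊕ P 1 ⇉ P 5 ⊕ P 1
star⁺⁺+P₁⇉ t = ⇉-⊕ (star⁺⁺⇉ t) (⇉-refl (P 1))

copies+P₃⇉ : ∀ t → copies t (P 1) ⊕ P 3 ⇉ P 1 ⊕ P 3
copies+P₃⇉ t = ⇉-⊕ (copies⇉ t) (⇉-refl (P 3))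

2star⇉ : ∀ t → copies 2 (Star1 t) ⇉ copies 2 (P 2)
2star⇉ t = ⇉-⊕ (star⇉ t) (⇉-⊕ (star⇉ t) (⇉-refl K0))

-- The outcome of the search serves as the condition itself: it is decidable, and completeness of
-- the search derives it from a full homomorphism.
_⇉ᵇ_ : Graph → Graph → Set
H ⇉ᵇ G = T (hom? H G)

⇉→⇉ᵇ : ∀ {H G} → H ⇉ G → H ⇉ᵇ G
⇉→⇉ᵇ f = Equivalence.from T-≡ (hom?-complete f)

-- The six classes are not listed

-- Listed X Y without (G1) and (G2), weakened to a decidable condition: the infinite
-- families are replaced by the finite graphs they map onto.
Possible : Graph → Graph → Set
Possible X Y =
  ((X ↪ P 4) ⊎ (Y ↪ P 4))
  ⊎ ((co X ⇉ᵇ (P 2 ⊕ P 1)) × (Y ⇉ᵇ (P 2 ⊕ P 1)))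
  ⊎ ((co X ⇉ᵇ (P 1 ⊕ P 3)) × (Y ⇉ᵇ (P 1 ⊕ P 3)))
  ⊎ ((co X ⇉ᵇ P 1) × ((Y ⇉ᵇ copies 2 (P 2)) ⊎ (Y ⇉ᵇ P 4) ⊎ (Y ↪ P 5)))
  ⊎ ((X ↪ paw) × ((Y ↪ P 2 ⊕ P 4) ⊎ (Y ↪ P 6) ⊎ (Y ↪ S 1 2 2) ⊎ (Y ⇉ᵇ (P 5 ⊕ P 1))))
  ⊎ ((X ↪ diamond) × (Y ↪ P 1 ⊕ copies 2 (P 2)))
  ⊎ ((X ↪ gem) × ((Y ↪ P 1 ⊕ P 4) ⊎ (Y ↪ P 5)))
  ⊎ ((X ↪ co (copies 2 (P 1) ⊕ P 3)) × ((Y ↪ P 2 ⊕ P 3) ⊎ (Y ↪ P 5)))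
  -- The empty summands in the places of (G1) and (G2) let the patterns for `Listed` serve here too.
  ⊎ ⊥
  ⊎ ⊥
  ⊎ ((K 3 ↪ X) × ((copies 2 (P 1) ⊕ copies 2 (P 2) ↪ Y) ⊎ (P 1 ⊕ copies 2 (P 3) ↪ Y)
      ⊎ (copies 2 (P 1) ⊕ P 4 ↪ Y) ⊎ (copies 3 (P 2) ↪ Y)))
  ⊎ ((K 4 ↪ X) × ((Star1⁺⁺ 4 ↪ Y) ⊎ (P 1 ⊕ copies 2 (P 2) ↪ Y) ⊎ (P 1 ⊕ P 4 ↪ Y)))
  ⊎ ((K 5 ↪ X) × (Star1⁺⁺ 3 ↪ Y))
  ⊎ ((C 4 ↪ X) × ((Star1 3 ↪ Y) ⊎ (copies 3 (P 1) ⊕ P 2 ↪ Y) ⊎ (copies 2 (P 2) ↪ Y)))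
  ⊎ ((diamond ↪ X) × ((Star1 3 ↪ Y) ⊎ (P 2 ⊕ P 4 ↪ Y) ⊎ (copies 2 (P 3) ↪ Y) ⊎ (P 6 ↪ Y)))
  ⊎ ((gem ↪ X) × (P 1 ⊕ copies 2 (P 2) ↪ Y))

possible? : ∀ X Y → Dec (Possible X Y)
possible? X Y =
  ((X ↪? P 4) ⊎-dec (Y ↪? P 4))
  ⊎-dec (T? (hom? (co X) (P 2 ⊕ P 1)) ×-dec T? (hom? Y (P 2 ⊕ P 1)))
  ⊎-dec (T? (hom? (co X) (P 1 ⊕ P 3)) ×-dec T? (hom? Y (P 1 ⊕ P 3)))
  ⊎-dec (T? (hom? (co X) (P 1)) ×-dec (T? (hom? Y (copies 2 (P 2))) ⊎-dec T? (hom? Y (P 4)) ⊎-dec (Y ↪? P 5)))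
  ⊎-dec ((X ↪? paw) ×-dec ((Y ↪? (P 2 ⊕ P 4)) ⊎-dec (Y ↪? P 6) ⊎-dec (Y ↪? S 1 2 2) ⊎-dec T? (hom? Y (P 5 ⊕ P 1))))
  ⊎-dec ((X ↪? diamond) ×-dec (Y ↪? (P 1 ⊕ copies 2 (P 2))))
  ⊎-dec ((X ↪? gem) ×-dec ((Y ↪? (P 1 ⊕ P 4)) ⊎-dec (Y ↪? P 5)))
  ⊎-dec ((X ↪? co (copies 2 (P 1) ⊕ P 3)) ×-dec ((Y ↪? (P 2 ⊕ P 3)) ⊎-dec (Y ↪? P 5)))
  ⊎-dec no id
  ⊎-dec no id
  ⊎-dec ((K 3 ↪? X) ×-dec (((copies 2 (P 1) ⊕ copies 2 (P 2)) ↪? Y) ⊎-dec ((P 1 ⊕ copies 2 (P 3)) ↪? Y)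
      ⊎-dec ((copies 2 (P 1) ⊕ P 4) ↪? Y) ⊎-dec (copies 3 (P 2) ↪? Y)))
  ⊎-dec ((K 4 ↪? X) ×-dec ((Star1⁺⁺ 4 ↪? Y) ⊎-dec ((P 1 ⊕ copies 2 (P 2)) ↪? Y) ⊎-dec ((P 1 ⊕ P 4) ↪? Y)))
  ⊎-dec ((K 5 ↪? X) ×-dec (Star1⁺⁺ 3 ↪? Y))
  ⊎-dec ((C 4 ↪? X) ×-dec ((Star1 3 ↪? Y) ⊎-dec ((copies 3 (P 1) ⊕ P 2) ↪? Y) ⊎-dec (copies 2 (P 2) ↪? Y)))
  ⊎-dec ((diamond ↪? X) ×-dec ((Star1 3 ↪? Y) ⊎-dec ((P 2 ⊕ P 4) ↪? Y) ⊎-dec (copies 2 (P 3) ↪? Y) ⊎-dec (P 6 ↪? Y)))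
  ⊎-dec ((gem ↪? X) ×-dec ((P 1 ⊕ copies 2 (P 2)) ↪? Y))

-- On arbitrary `H₁` and `H₂` the search cannot be evaluated. The conditions are moved to isomorphic
-- `X` and `Y`, which are concrete graphs in the applications.
listed→possible : ∀ {H₁ H₂ X Y} → X ~ H₁ → Y ~ H₂ → Listed H₁ H₂ →
  (¬ PathStarForest H₁ × ¬ PathStarForest H₂) ⊎ (¬ PathStarForest (co H₁) × ¬ PathStarForest (co H₂)) ⊎ Possible X Y
listed→possible {H₁} {H₂} {X} {Y} x y = go
  where
  inX : ∀ {G} → H₁ ⊆ᵢ G → X ↪ G
  inX f = to x ⨾ ⊆→↪ f
  inY : ∀ {G} → H₂ ⊆ᵢ G → Y ↪ G
  inY f = to y ⨾ ⊆→↪ f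
  ofX : ∀ {G} → G ⊆ᵢ H₁ → G ↪ X
  ofX f = ⊆→↪ f ⨾ from x
  ofY : ∀ {G} → G ⊆ᵢ H₂ → G ↪ Y
  ofY f = ⊆→↪ f ⨾ from y
  viaX : ∀ {G Q} → co H₁ ⊆ᵢ G → G ⇉ Q → co X ⇉ᵇ Q
  viaX {G} {Q} f q = ⇉→⇉ᵇ {co X} {Q} ((co-↪ (to x) ⨾ ⊆→↪ f) ⨾⇉ q)
  viaY : ∀ {G Q} → H₂ ⊆ᵢ G → G ⇉ Q → Y ⇉ᵇ Q
  viaY {G} {Q} f q = ⇉→⇉ᵇ {Y} {Q} (inY f ⨾⇉ q)
  viaK : ∀ t → H₁ ⊆ᵢ K t → co X ⇉ᵇ P 1
  viaK t f = ⇉→⇉ᵇ {co X} {P 1} (co-↪ (inX {K t} f) ⨾⇉ co-K⇉ t)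
  possible : ∀ {A B : Set} → Possible X Y → A ⊎ B ⊎ Possible X Y
  possible = inj₂ ∘ inj₂
  go : Listed H₁ H₂ → (¬ PathStarForest H₁ × ¬ PathStarForest H₂)
    ⊎ (¬ PathStarForest (co H₁) × ¬ PathStarForest (co H₂)) ⊎ Possible X Y
  go (⟪P1⟫ (inj₁ f)) = possible (⟪P1⟫ (inj₁ (inX f)))
  go (⟪P1⟫ (inj₂ g)) = possible (⟪P1⟫ (inj₂ (inY g)))
  go (⟪P2⟫ (t , _ , f , g)) = possible (⟪P2⟫ (viaX f (star+P₁⇉ t) , viaY g (star+P₁⇉ t)))
  go (⟪P3⟫ (t , _ , f , g)) = possible (⟪P3⟫ (viaX f (copies+P₃⇉ t) , viaY g (copies+P₃⇉ t)))
  go (⟪P4⟫ (t , _ , f , inj₁ g)) = possible (⟪P4⟫ (viaK t f , inj₁ (viaY g (2star⇉ t))))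
  go (⟪P4⟫ (t , _ , f , inj₂ (inj₁ g))) = possible (⟪P4⟫ (viaK t f , inj₂ (inj₁ (viaY g (star⁺⇉ t)))))
  go (⟪P4⟫ (t , _ , f , inj₂ (inj₂ g))) = possible (⟪P4⟫ (viaK t f , inj₂ (inj₂ (inY g))))
  go (⟪P5⟫ (f , inj₁ g)) = possible (⟪P5⟫ (inX f , inj₁ (inY g)))
  go (⟪P5⟫ (f , inj₂ (inj₁ g))) = possible (⟪P5⟫ (inX f , inj₂ (inj₁ (inY g))))
  go (⟪P5⟫ (f , inj₂ (inj₂ (inj₁ g)))) = possible (⟪P5⟫ (inX f , inj₂ (inj₂ (inj₁ (inY g)))))
  go (⟪P5⟫ (f , inj₂ (inj₂ (inj₂ (t , _ , g))))) =
    possible (⟪P5⟫ (inX f , inj₂ (inj₂ (inj₂ (viaY g (star⁺⁺+P₁⇉ t))))))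
  go (⟪P6⟫ (f , g)) = possible (⟪P6⟫ (inX f , inY g))
  go (⟪P7⟫ (f , inj₁ g)) = possible (⟪P7⟫ (inX f , inj₁ (inY g)))
  go (⟪P7⟫ (f , inj₂ g)) = possible (⟪P7⟫ (inX f , inj₂ (inY g)))
  go (⟪P8⟫ (f , inj₁ g)) = possible (⟪P8⟫ (inX f , inj₁ (inY g)))
  go (⟪P8⟫ (f , inj₂ g)) = possible (⟪P8⟫ (inX f , inj₂ (inY g)))
  go (⟪G1⟫ n) = inj₁ n
  go (⟪G2⟫ n) = inj₂ (inj₁ n)
  go (⟪G3⟫ (f , inj₁ g)) = possible (⟪G3⟫ (ofX f , inj₁ (ofY g)))
  go (⟪G3⟫ (f , inj₂ (inj₁ g))) = possible (⟪G3⟫ (ofX f , inj₂ (inj₁ (ofY g))))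
  go (⟪G3⟫ (f , inj₂ (inj₂ (inj₁ g)))) = possible (⟪G3⟫ (ofX f , inj₂ (inj₂ (inj₁ (ofY g)))))
  go (⟪G3⟫ (f , inj₂ (inj₂ (inj₂ g)))) = possible (⟪G3⟫ (ofX f , inj₂ (inj₂ (inj₂ (ofY g)))))
  go (⟪G4⟫ (f , inj₁ g)) = possible (⟪G4⟫ (ofX f , inj₁ (ofY g)))
  go (⟪G4⟫ (f , inj₂ (inj₁ g))) = possible (⟪G4⟫ (ofX f , inj₂ (inj₁ (ofY g))))
  go (⟪G4⟫ (f , inj₂ (inj₂ g))) = possible (⟪G4⟫ (ofX f , inj₂ (inj₂ (ofY g))))
  go (⟪G5⟫ (f , g)) = possible (⟪G5⟫ (ofX f , ofY g))
  go (⟪G6⟫ (f , inj₁ g)) = possible (⟪G6⟫ (ofX f , inj₁ (ofY g)))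
  go (⟪G6⟫ (f , inj₂ (inj₁ g))) = possible (⟪G6⟫ (ofX f , inj₂ (inj₁ (ofY g))))
  go (⟪G6⟫ (f , inj₂ (inj₂ g))) = possible (⟪G6⟫ (ofX f , inj₂ (inj₂ (ofY g))))
  go (⟪G7⟫ (f , inj₁ g)) = possible (⟪G7⟫ (ofX f , inj₁ (ofY g)))
  go (⟪G7⟫ (f , inj₂ (inj₁ g))) = possible (⟪G7⟫ (ofX f , inj₂ (inj₁ (ofY g))))
  go (⟪G7⟫ (f , inj₂ (inj₂ (inj₁ g)))) = possible (⟪G7⟫ (ofX f , inj₂ (inj₂ (inj₁ (ofY g)))))
  go (⟪G7⟫ (f , inj₂ (inj₂ (inj₂ g)))) = possible (⟪G7⟫ (ofX f , inj₂ (inj₂ (inj₂ (ofY g)))))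
  go (⟪G8⟫ (f , g)) = possible (⟪G8⟫ (ofX f , ofY g))

-- Together with `psf-co-left` this defeats (G1) and (G2): in each base pair the right graph and the
-- complement of the left one are path star forests. A path is given as one leg from an end vertex,
-- P₁ as no leg.
psf-right : ∀ b → Σ (List (List ℕ)) λ lss → right b ~ spiders lss
psf-right k3-p7        = (6 ∷ []) ∷ [] , (emb! ⇄ emb!)
psf-right k3-s123      = (1 ∷ 2 ∷ 3 ∷ []) ∷ [] , (emb! ⇄ emb!)
psf-right paw-p7       = (6 ∷ []) ∷ [] , (emb! ⇄ emb!)
psf-right paw-s123     = (1 ∷ 2 ∷ 3 ∷ []) ∷ [] , (emb! ⇄ emb!)
psf-right k4-s113      = (1 ∷ 1 ∷ 3 ∷ []) ∷ [] , (emb! ⇄ emb!)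
psf-right diamond-p123 = [] ∷ (1 ∷ []) ∷ (2 ∷ []) ∷ [] , (emb! ⇄ emb!)
psf-right diamond-p15  = [] ∷ (4 ∷ []) ∷ [] , (emb! ⇄ emb!)
psf-right gem-p23      = (1 ∷ []) ∷ (2 ∷ []) ∷ [] , (emb! ⇄ emb!)

psf-co-left : ∀ b → Σ (List (List ℕ)) λ lss → co (left b) ~ spiders lss
psf-co-left k3-p7        = [] ∷ [] ∷ [] ∷ [] , (emb! ⇄ emb!)
psf-co-left k3-s123      = [] ∷ [] ∷ [] ∷ [] , (emb! ⇄ emb!)
psf-co-left paw-p7       = [] ∷ (2 ∷ []) ∷ [] , (emb! ⇄ emb!)
psf-co-left paw-s123     = [] ∷ (2 ∷ []) ∷ [] , (emb! ⇄ emb!)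
psf-co-left k4-s113      = [] ∷ [] ∷ [] ∷ [] ∷ [] , (emb! ⇄ emb!)
psf-co-left diamond-p123 = [] ∷ [] ∷ (1 ∷ []) ∷ [] , (emb! ⇄ emb!)
psf-co-left diamond-p15  = [] ∷ [] ∷ (1 ∷ []) ∷ [] , (emb! ⇄ emb!)
psf-co-left gem-p23      = [] ∷ (3 ∷ []) ∷ [] , (emb! ⇄ emb!)

refute : ∀ X Y → {t : False (possible? X Y)} → ¬ Possible X Y
refute X Y {t} = toWitnessFalse t

-- The list treats its two graphs differently, and likewise a pair and its complement, so both
-- orders of all sixteen pairs are checked.
impossible : ∀ b → ¬ Possible (left b) (right b) × ¬ Possible (right b) (left b)
  × ¬ Possible (co (left b)) (co (right b)) × ¬ Possible (co (right b)) (co (left b))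
impossible k3-p7 =
  refute (K 3) (P 7) , refute (P 7) (K 3) ,
  refute (co (K 3)) (co (P 7)) , refute (co (P 7)) (co (K 3))
impossible k3-s123 =
  refute (K 3) (S 1 2 3) , refute (S 1 2 3) (K 3) ,
  refute (co (K 3)) (co (S 1 2 3)) , refute (co (S 1 2 3)) (co (K 3))
impossible paw-p7 =
  refute paw (P 7) , refute (P 7) paw ,
  refute (co paw) (co (P 7)) , refute (co (P 7)) (co paw)
impossible paw-s123 =
  refute paw (S 1 2 3) , refute (S 1 2 3) paw ,
  refute (co paw) (co (S 1 2 3)) , refute (co (S 1 2 3)) (co paw)
impossible k4-s113 =
  refute (K 4) (S 1 1 3) , refute (S 1 1 3) (K 4) ,
  refute (co (K 4)) (co (S 1 1 3)) , refute (co (S 1 1 3)) (co (K 4))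
impossible diamond-p123 =
  refute diamond (P 1 ⊕ P 2 ⊕ P 3) , refute (P 1 ⊕ P 2 ⊕ P 3) diamond ,
  refute (co diamond) (co (P 1 ⊕ P 2 ⊕ P 3)) , refute (co (P 1 ⊕ P 2 ⊕ P 3)) (co diamond)
impossible diamond-p15 =
  refute diamond (P 1 ⊕ P 5) , refute (P 1 ⊕ P 5) diamond ,
  refute (co diamond) (co (P 1 ⊕ P 5)) , refute (co (P 1 ⊕ P 5)) (co diamond)
impossible gem-p23 =
  refute gem (P 2 ⊕ P 3) , refute (P 2 ⊕ P 3) gem ,
  refute (co gem) (co (P 2 ⊕ P 3)) , refute (co (P 2 ⊕ P 3)) (co gem)

psf-resp : ∀ G {H} → (Σ (List (List ℕ)) λ lss → H ~ spiders lss) → G ~ H → PathStarForest G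
psf-resp G (lss , e) f = lss , ~→≅ {G} {spiders lss} (~-trans f e)

unlisted : ∀ H₁ H₂ X Y → H₁ ~ X → H₂ ~ Y → PathStarForest H₁ ⊎ PathStarForest H₂ →
  PathStarForest (co H₁) ⊎ PathStarForest (co H₂) → ¬ Possible X Y → ¬ Listed H₁ H₂
unlisted H₁ H₂ X Y f g p q ¬r l = case listed→possible (~-sym f) (~-sym g) l of λ
  { (inj₁ (n₁ , n₂))        → [ n₁ , n₂ ]′ p
  ; (inj₂ (inj₁ (n₁ , n₂))) → [ n₁ , n₂ ]′ q
  ; (inj₂ (inj₂ r))         → ¬r r }

inSix-unlisted : ∀ {H₁ H₂} → InSix (H₁ , H₂) → ¬ Listed H₁ H₂
inSix-unlisted {H₁} {H₂} (b , straight f g) = unlisted H₁ H₂ (left b) (right b) f g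
  (inj₂ (psf-resp H₂ (psf-right b) g)) (inj₁ (psf-resp (co H₁) (psf-co-left b) (co-~ f)))
  (proj₁ (impossible b))
inSix-unlisted {H₁} {H₂} (b , crossed f g) = unlisted H₁ H₂ (right b) (left b) f g
  (inj₁ (psf-resp H₁ (psf-right b) f)) (inj₂ (psf-resp (co H₂) (psf-co-left b) (co-~ g)))
  (proj₁ (proj₂ (impossible b)))
inSix-unlisted {H₁} {H₂} (b , co-straight f g) = unlisted H₁ H₂ (co (left b)) (co (right b)) f g
  (inj₁ (psf-resp H₁ (psf-co-left b) f))
  (inj₂ (psf-resp (co H₂) (psf-right b) (~-trans (co-~ g) (co-co (right b)))))
  (proj₁ (proj₂ (proj₂ (impossible b))))
inSix-unlisted {H₁} {H₂} (b , co-crossed f g) = unlisted H₁ H₂ (co (right b)) (co (left b)) f g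
  (inj₂ (psf-resp H₂ (psf-co-left b) g))
  (inj₁ (psf-resp (co H₁) (psf-right b) (~-trans (co-~ f) (co-co (right b)))))
  (proj₂ (proj₂ (proj₂ (impossible b))))

theorem11 : (A B : Graph) →
    ((¬ Σ Graph (λ H1 → Σ Graph (λ H2 → Listed H1 H2 × EquivClass (A , B) (H1 , H2))))
    → Σ Pair (λ Q → SixPairs Q × EquivClass (A , B) Q))
    × (Σ Pair (λ Q → SixPairs Q × EquivClass (A , B) Q)
    → ¬ Σ Graph (λ H1 → Σ Graph (λ H2 → Listed H1 H2 × EquivClass (A , B) (H1 , H2))))
theorem11 A B = forward , backward
  where
  forward : ¬ EquivalentToListed (A , B) → Σ Pair (λ Q → SixPairs Q × EquivClass (A , B) Q)
  forward ¬l = inSix→sixPairs (decidable-stable (inSix? (A , B)) λ ¬s → ¬¬settled A B [ ¬l , ¬s ]′)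
  backward : Σ Pair (λ Q → SixPairs Q × EquivClass (A , B) Q) → ¬ EquivalentToListed (A , B)
  backward (_ , q , e) (_ , _ , l , e′) =
    -- Pulling `InSix` back along `e` and pushing it forward along `e′` makes the listed pair itself
    -- one of the sixteen.
    inSix-unlisted (inSix-class e′ (inSix-unclass e (sixPairs→inSix q))) l
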